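{- Let $m>1$, $d\ge 1$, and let $\sigma_1,\ldots,\sigma_d\in S_m$. Then there exist constants $c_2>c_1>0$ (depending on the $\sigma_i$) such that for all positive integers $n$, \[c_1^n\, n^{n\frac{d^2-1}{d}}\leq S_n^d(\sigma_1,\ldots,\sigma_d)\leq c_2^n\, n^{n\frac{d^2-1}{d}}.\]
   Context: A $d$-tuple $(\tau_1,\ldots,\tau_d)$ of permutations in $S_n$ contains $(\sigma_1,\ldots,\sigma_d)$ (permutations in $S_m$) in parallel if there exist indices $c_1<\cdots<c_m$ in $[n]$ such that for each $i\in[d]$ the sequence $\tau_i(c_1)\cdots\tau_i(c_m)$ is order-isomorphic to $\sigma_i$; otherwise it avoids it in parallel. $S_n^d(\sigma_1,\ldots,\sigma_d)$ denotes the number of $d$-tuples $(\tau_1,\ldots,\tau_d)\in S_n^d$ that avoid $(\sigma_1,\ldots,\sigma_d)$ in parallel. -}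

module Defs where

open import Data.Nat using (ℕ; zero; suc; _<ᵇ_; _≡ᵇ_)
open import Data.Bool using (Bool; true; false; not; _∧_; _∨_)
open import Data.Fin using (Fin; toℕ)
open import Data.Vec using (Vec; lookup)
open import Data.Vec as V using ()
open import Data.List using (List; []; _∷_; [_]; concatMap; map; filterᵇ; length; allFin)
open import Data.Rational using (ℚ; 1ℚ; _*_)

all : ∀ {A : Set} → (A → Bool) → List A → Bool
all p []       = true
all p (x ∷ xs) = p x ∧ all p xs

any : ∀ {A : Set} → (A → Bool) → List A → Bool
any p []       = false
any p (x ∷ xs) = p x ∨ any p xs

_==_ : Bool → Bool → Bool
a == b = (a ∧ b) ∨ (not a ∧ not b)

allVecs : ∀ {A : Set} (k : ℕ) → List A → List (Vec A k)
allVecs zero    xs = [ V.[] ]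
allVecs (suc k) xs = concatMap (λ x → map (x V.∷_) (allVecs k xs)) xs

_<F_ : ∀ {n} → Fin n → Fin n → Bool
a <F b = toℕ a <ᵇ toℕ b

_=F_ : ∀ {n} → Fin n → Fin n → Bool
a =F b = toℕ a ≡ᵇ toℕ b

-- A permutation of [n] (0-based) in one-line notation: an injective
-- Vec (Fin n) n (injective on a finite set of size n = bijective).
isPermB : ∀ {n} → Vec (Fin n) n → Bool
isPermB {n} v =
  all (λ i → all (λ j → (i =F j) ∨ not (lookup v i =F lookup v j)) (allFin n)) (allFin n)

perms : (n : ℕ) → List (Vec (Fin n) n)
perms n = filterᵇ isPermB (allVecs n (allFin n))

increasingB : ∀ {m n} → Vec (Fin n) m → Bool
increasingB {m} c =
  all (λ j → all (λ k → not (j <F k) ∨ (lookup c j <F lookup c k)) (allFin m)) (allFin m)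

orderIsoB : ∀ {m n} → Vec (Fin m) m → Vec (Fin n) n → Vec (Fin n) m → Bool
orderIsoB {m} σ τ c =
  all (λ j → all (λ k →
      (lookup τ (lookup c j) <F lookup τ (lookup c k)) == (lookup σ j <F lookup σ k))
    (allFin m)) (allFin m)

containsParB : ∀ {m n d} → Vec (Vec (Fin m) m) d → Vec (Vec (Fin n) n) d → Bool
containsParB {m} {n} {d} σs τs =
  any (λ c → increasingB c ∧ all (λ i → orderIsoB (lookup σs i) (lookup τs i) c) (allFin d))
      (allVecs m (allFin n))

S : (n : ℕ) → ∀ {m d} → Vec (Vec (Fin m) m) d → ℕ
S n {m} {d} σs = length (filterᵇ (λ τs → not (containsParB σs τs)) (allVecs d (perms n)))

_^ℚ_ : ℚ → ℕ → ℚ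
q ^ℚ zero  = 1ℚ
q ^ℚ suc k = q * (q ^ℚ k)

{-# OPTIONS --safe #-}
-- A d-tuple of permutations of [n] is the set of points (c, τ₁ c, …, τ_d c) in [n]^(d+1).
--
-- Upper bound. By the argument of Marcus–Tardos and Klazar–Marcus, a subset of [N]^(d+1)
-- avoiding a permutation pattern has O(N^d) points, hence (Klazar) there are only 2^O(N^d) such
-- subsets. Take N ≈ n^(1/d) and cut [n]^(d+1) into cells of side w ≈ n/N: the occupied cells can
-- be chosen in 2^O(n) ways, each position then has at most w cells to lie in and w^d places
-- inside its cell, and w^(n(d+1)) ≈ n^(n(d²-1)/d).
--
-- Lower bound. It is enough to avoid the pattern formed by two entries of the σᵢ; assume it is
-- increasing everywhere. Label the n points by distinct vectors in [N]^d, order them along d of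
-- the axes by the digits of the label and along the other one by decreasing digit sum. However
-- ties are broken, no point lies below another, and breaking ties in all possible ways gives
-- c^n n^(n(d²-1)/d) tuples.

module Submission where

open import Defs

-- Counting stays in ℕ and in `d`-th powers, so that no root occurs: N ≈ n^(1/d) becomes a power
-- `s ^ j` with `(s ^ j) ^ d ≤ n < (s ^ suc j) ^ d`.
--
-- The linear extremal bound is an induction on the dimension as well as on the side. Merging cells
-- along an axis loses at most a factor κ = m - 1, except in columns holding more than κ points, and
-- those project to avoiding sets of one dimension less. Merging along all d+1 axes costs κ^(d+1),
-- while the target bound gains s^d; this decides how large s must be.
--
-- The families of candidate sets also contain lists that come from no avoiding tuple. Truncation
-- keeps the counts valid for them, and the extremal bound shows that it cuts nothing from the lists
-- that matter.
--
-- In the lower bound, ties are not broken by permutations of each level, whose number is a product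
-- of factorials, but by seeds in `Fin q` with q about n divided by the number of levels. Different
-- seeds may give the same order; the counting function of the keys, one of 2^O(n) sequences, tells
-- them apart.

module Enumeration where

  open import Data.Nat using (ℕ; zero; suc; _+_; _*_; _∸_; _^_; _/_; _%_; _≤_; _<_; _≤?_; _<?_; _<ᵇ_; _≡ᵇ_; z≤n; s≤s; s<s; z<s; NonZero; >-nonZero; >-nonZero⁻¹)
  open import Data.Nat.Properties
  open import Data.Nat.DivMod
  open import Data.Nat.Tactic.RingSolver using (solve-∀)
  open import Data.Bool using (Bool; true; false; not; _∧_; _∨_; T)
  open import Data.Bool.Properties using (T-≡)
  open import Data.Fin using (Fin; zero; suc; toℕ; fromℕ<; inject≤)
  open import Data.Fin.Properties using (toℕ-injective; toℕ<n; toℕ-fromℕ<; toℕ-inject≤; injective⇒≤; any?) renaming (_≟_ to _≟ᶠ_)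
  open import Data.Unit using (tt)
  open import Data.List using (List; []; _∷_; [_]; _++_; length; map; concatMap; filter; filterᵇ; take; upTo; allFin; replicate; deduplicate; cartesianProductWith; lookup)
  open import Data.List.Properties using (∷ʳ-injective; ++-assoc; ++-identityʳ; length-map; length-++; length-upTo; length-take; length-tabulate; ≡-dec; length-replicate; length-filter; ∷-injective; ∷-injectiveˡ; ∷-injectiveʳ)
  open import Data.List.Membership.Propositional using (_∈_; lose)
  open import Data.List.Membership.Propositional.Properties
  open import Data.List.Relation.Unary.Any using (here; there; index)
  open import Data.List.Relation.Unary.Any.Properties using (lookup-index)
  open import Data.List.Relation.Unary.All as All using (All; []; _∷_)
  open import Data.List.Relation.Unary.AllPairs as AllPairs using (AllPairs; []; _∷_)
  import Data.List.Relation.Unary.AllPairs.Properties as AllPairs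
  open import Data.List.Relation.Unary.Unique.Propositional using (Unique)
  import Data.List.Relation.Unary.Unique.Propositional.Properties as Unique
  import Data.List.Relation.Unary.Unique.DecPropositional.Properties as UniqueDec
  open import Data.List.Relation.Binary.Pointwise as Pointwise using (Pointwise; []; _∷_)
  open import Data.Vec as V using (Vec; []; _∷_)
  import Data.Vec.Properties as V
  open import Data.Product using (Σ; ∃; ∃₂; _×_; _,_; proj₁; proj₂)
  open import Data.Product.Properties using (,-injective) renaming (≡-dec to ×-≡-dec)
  open import Data.Sum using (inj₁; inj₂)
  open import Function using (_∘_; id; Equivalence)
  open import Relation.Nullary using (¬_; yes; no; contradiction)
  open import Relation.Nullary.Decidable using (T?)
  open import Relation.Unary using (Decidable)
  open import Relation.Binary.Definitions using (DecidableEquality; tri<; tri≈; tri>)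
  open import Relation.Binary.PropositionalEquality using (_≡_; _≢_; refl; sym; trans; cong; cong₂; subst; subst₂; module ≡-Reasoning)


  -- Counting lists

  variable
    X Y Z : Set

  length-⊆ : {xs ys : List X} → Unique xs → (∀ {x} → x ∈ xs → x ∈ ys) → length xs ≤ length ys
  length-⊆ {xs = xs} {ys} xs! sub = injective⇒≤ {f = λ i → index (sub (∈-lookup i))} λ {i} {j} eq →
    lookup-injective xs! i j
      (trans (lookup-index (sub (∈-lookup i)))
      (trans (cong (lookup ys) eq) (sym (lookup-index (sub (∈-lookup j))))))
    where
    lookup-injective : {xs : List X} → Unique xs → ∀ i j → lookup xs i ≡ lookup xs j → i ≡ j
    lookup-injective (_ ∷ _)   zero    zero    _  = refl
    lookup-injective (x∉ ∷ _)  zero    (suc j) eq = contradiction eq (All.lookup x∉ (∈-lookup j))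
    lookup-injective (x∉ ∷ _)  (suc i) zero    eq = contradiction (sym eq) (All.lookup x∉ (∈-lookup i))
    lookup-injective (_ ∷ xs!) (suc i) (suc j) eq = cong suc (lookup-injective xs! i j eq)

  map-unique : (f : X → Y) {xs : List X} → Unique xs →
    (∀ {x y} → x ∈ xs → y ∈ xs → f x ≡ f y → x ≡ y) → Unique (map f xs)
  map-unique f []         inj = []
  map-unique f (x∉ ∷ xs!) inj =
    All.tabulate (λ y∈ eq → let z , z∈ , y≡ = ∈-map⁻ f y∈ in
      All.lookup x∉ z∈ (inj (here refl) (there z∈) (trans eq y≡)))
    ∷ map-unique f xs! (λ x∈ y∈ → inj (there x∈) (there y∈))

  length-injection : (f : X → Y) {xs : List X} {ys : List Y} → Unique xs →
    (∀ {x} → x ∈ xs → f x ∈ ys) →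
    (∀ {x y} → x ∈ xs → y ∈ xs → f x ≡ f y → x ≡ y) → length xs ≤ length ys
  length-injection f {xs} {ys} xs! into inj =
    subst (_≤ length ys) (length-map f xs)
      (length-⊆ (map-unique f xs! inj) λ y∈ → let x , x∈ , eq = ∈-map⁻ f y∈ in subst (_∈ ys) (sym eq) (into x∈))

  ∈-concatMap : (f : X → List Y) {xs : List X} {x : X} {y : Y} → x ∈ xs → y ∈ f x → y ∈ concatMap f xs
  ∈-concatMap f x∈ y∈ = ∈-concatMap⁺ f (lose x∈ y∈)

  length-concatMap-≤ : (f : X → List Y) (b : ℕ) (xs : List X) →
    (∀ {x} → x ∈ xs → length (f x) ≤ b) → length (concatMap f xs) ≤ length xs * b
  length-concatMap-≤ f b []       h = z≤n
  length-concatMap-≤ f b (x ∷ xs) h = ≤-trans (≤-reflexive (length-++ (f x)))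
    (+-mono-≤ (h (here refl)) (length-concatMap-≤ f b xs (h ∘ there)))

  length-fibres : (_≟_ : DecidableEquality Y) (f : X → Y) (b : ℕ) {xs : List X} {ys : List Y} → Unique xs →
    (∀ {x} → x ∈ xs → f x ∈ ys) → (∀ y → length (filter (λ x → f x ≟ y) xs) ≤ b) →
    length xs ≤ length ys * b
  length-fibres _≟_ f b {xs} {ys} xs! into h = ≤-trans
    (length-⊆ xs! λ x∈ → ∈-concatMap (λ y → filter (λ x → f x ≟ y) xs) (into x∈) (∈-filter⁺ (λ x → f x ≟ f _) x∈ refl))
    (length-concatMap-≤ _ b ys λ _ → h _)

  -- Elements with `P` are charged `c` on top of the common rate `b`, so the first term runs over
  -- all of `xs`. In the extremal argument it becomes the narrow-column term `κ * length A'`.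
  length-split : {P : X → Set} (P? : Decidable P) (f : X → List Y) (b c : ℕ) (xs : List X) →
    (∀ {x} → x ∈ xs → length (f x) ≤ c) → (∀ {x} → x ∈ xs → ¬ P x → length (f x) ≤ b) →
    length (concatMap f xs) ≤ b * length xs + c * length (filter P? xs)
  length-split P? f b c []       _  _  = z≤n
  length-split P? f b c (x ∷ xs) hc hb with length-split P? f b c xs (hc ∘ there) (hb ∘ there) | P? x
  ... | ih | yes _ = begin
    length (f x ++ concatMap f xs)                                   ≡⟨ length-++ (f x) ⟩
    length (f x) + length (concatMap f xs)                           ≤⟨ +-mono-≤ (hc (here refl)) ih ⟩
    c + (b * length xs + c * length (filter P? xs))                  ≤⟨ m≤n+m _ b ⟩
    b + (c + (b * length xs + c * length (filter P? xs)))            ≡⟨ arith b c (length xs) _ ⟩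
    b * suc (length xs) + c * suc (length (filter P? xs))            ∎
    where
    open ≤-Reasoning
    arith : ∀ b c x y → b + (c + (b * x + c * y)) ≡ b * suc x + c * suc y
    arith = solve-∀
  ... | ih | no ¬p = begin
    length (f x ++ concatMap f xs)                                   ≡⟨ length-++ (f x) ⟩
    length (f x) + length (concatMap f xs)                           ≤⟨ +-mono-≤ (hb (here refl) ¬p) ih ⟩
    b + (b * length xs + c * length (filter P? xs))                  ≡⟨ arith b (length xs) _ ⟩
    b * suc (length xs) + c * length (filter P? xs)                  ∎
    where
    open ≤-Reasoning
    arith : ∀ b x z → b + (b * x + z) ≡ b * suc x + z
    arith = solve-∀

  sublists : List X → List (List X)
  sublists []       = [ [] ]
  sublists (x ∷ xs) = map (x ∷_) (sublists xs) ++ sublists xs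

  length-sublists : (xs : List X) → length (sublists xs) ≡ 2 ^ length xs
  length-sublists []       = refl
  length-sublists (x ∷ xs) = begin
    length (map (x ∷_) (sublists xs) ++ sublists xs)          ≡⟨ length-++ (map (x ∷_) (sublists xs)) ⟩
    length (map (x ∷_) (sublists xs)) + length (sublists xs)  ≡⟨ cong (_+ length (sublists xs)) (length-map (x ∷_) (sublists xs)) ⟩
    length (sublists xs) + length (sublists xs)               ≡⟨ cong (λ z → z + z) (length-sublists xs) ⟩
    2 ^ length xs + 2 ^ length xs                             ≡⟨ cong (2 ^ length xs +_) (+-identityʳ _) ⟨
    2 ^ suc (length xs)                                       ∎
    where open ≡-Reasoning

  filter∈sublists : {P : X → Set} (P? : Decidable P) (xs : List X) → filter P? xs ∈ sublists xs
  filter∈sublists P? []       = here refl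
  filter∈sublists P? (x ∷ xs) with P? x
  ... | yes _ = ∈-++⁺ˡ (∈-map⁺ (x ∷_) (filter∈sublists P? xs))
  ... | no  _ = ∈-++⁺ʳ (map (x ∷_) (sublists xs)) (filter∈sublists P? xs)

  take-all : (n : ℕ) (xs : List X) → length xs ≤ n → take n xs ≡ xs
  take-all zero    []       _       = refl
  take-all (suc n) []       _       = refl
  take-all (suc n) (x ∷ xs) (s≤s h) = cong (x ∷_) (take-all n xs h)

  length-take-≤ : (n : ℕ) (xs : List X) → length (take n xs) ≤ n
  length-take-≤ n xs = ≤-trans (≤-reflexive (length-take n xs)) (m⊓n≤m n (length xs))

  length-snoc : (xs : List X) (x : X) → length (xs ++ [ x ]) ≡ suc (length xs)
  length-snoc xs x = trans (length-++ xs) (+-comm (length xs) 1)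

  ^-distribʳ-* : ∀ e a b → (a * b) ^ e ≡ a ^ e * b ^ e
  ^-distribʳ-* zero    a b = refl
  ^-distribʳ-* (suc e) a b = trans (cong (a * b *_) (^-distribʳ-* e a b)) (arith a b (a ^ e) (b ^ e))
    where
    arith : ∀ a b x y → a * b * (x * y) ≡ a * x * (b * y)
    arith = solve-∀

  -- The extremal bound

  module Pattern {κ : ℕ} where

    Perm : Set
    Perm = Vec (Fin (suc κ)) (suc κ)

    Point : Set
    Point = List ℕ

    _≟ᵖ_ : DecidableEquality Point
    _≟ᵖ_ = ≡-dec _≟_

    open import Data.List.Membership.DecPropositional _≟ᵖ_ using (_∈?_)

    head₀ : Point → ℕ
    head₀ []      = 0
    head₀ (x ∷ _) = x

    tail₀ : Point → Point
    tail₀ []      = []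
    tail₀ (_ ∷ a) = a

    -- The condition is one-sided because strict inequalities between quotients lift to strict
    -- inequalities between the numbers. Points and patterns are lists so that the dimension can
    -- drop and the axes can be rotated.
    data Below (j j' : Fin (suc κ)) : List Perm → Point → Point → Set where
      []  : Below j j' [] [] []
      _∷_ : ∀ {π P x y a b} → (toℕ (V.lookup π j) < toℕ (V.lookup π j') → x < y) →
            Below j j' P a b → Below j j' (π ∷ P) (x ∷ a) (y ∷ b)

    -- Repeated values of `f` are allowed, so in dimension zero a single point contains the empty
    -- pattern; this starts the induction on the dimension.
    Contains : List Perm → List Point → Set
    Contains P A = Σ (Fin (suc κ) → Point) λ f → (∀ j → f j ∈ A) × (∀ j j' → Below j j' P (f j) (f j'))

    Avoids : List Perm → List Point → Set
    Avoids P A = ¬ Contains P A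

    InBox : List ℕ → Point → Set
    InBox bs a = Pointwise _<_ a bs

    contract : (s : ℕ) .{{_ : NonZero s}} → Point → Point
    contract s []      = []
    contract s (x ∷ a) = x / s ∷ a

    rotate : Point → Point
    rotate []      = []
    rotate (x ∷ a) = a ++ [ x ]

    rotate-injective : ∀ a b → rotate a ≡ rotate b → a ≡ b
    rotate-injective []      []      _  = refl
    rotate-injective []      (y ∷ b) eq = contradiction (trans (cong length eq) (length-snoc b y)) λ ()
    rotate-injective (x ∷ a) []      eq = contradiction (trans (sym (cong length eq)) (length-snoc a x)) λ ()
    rotate-injective (x ∷ a) (y ∷ b) eq = let a≡b , x≡y = ∷ʳ-injective a b eq in cong₂ _∷_ x≡y a≡b

    Below-length : ∀ {j j' P a b} → Below j j' P a b → length a ≡ length P × length b ≡ length P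
    Below-length []      = refl , refl
    Below-length (_ ∷ h) = let p , q = Below-length h in cong suc p , cong suc q

    Below-unsnoc : ∀ {j j'} P {π} a b {x y} → length a ≡ length P → length b ≡ length P →
      Below j j' (P ++ [ π ]) (a ++ [ x ]) (b ++ [ y ]) → Below j j' (π ∷ P) (x ∷ a) (y ∷ b)
    Below-unsnoc []      []      []      _  _  (p ∷ []) = p ∷ []
    Below-unsnoc (_ ∷ P) (_ ∷ a) (_ ∷ b) la lb (p ∷ h) with Below-unsnoc P a b (suc-injective la) (suc-injective lb) h
    ... | q ∷ h' = q ∷ p ∷ h'

    Below-rotate : ∀ {j j'} P {π} a b → Below j j' (P ++ [ π ]) (rotate a) (rotate b) → Below j j' (π ∷ P) a b
    Below-rotate P {π} []      b       h = contradiction (trans (proj₁ (Below-length h)) (length-snoc P π)) λ ()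
    Below-rotate P {π} (_ ∷ _) []      h = contradiction (trans (proj₂ (Below-length h)) (length-snoc P π)) λ ()
    Below-rotate P {π} (x ∷ a) (y ∷ b) h = let la , lb = Below-length h in Below-unsnoc P a b
      (suc-injective (trans (sym (length-snoc a x)) (trans la (length-snoc P π))))
      (suc-injective (trans (sym (length-snoc b y)) (trans lb (length-snoc P π)))) h

    quotient-<⇒< : ∀ s .{{_ : NonZero s}} x y → x / s < y / s → x < y
    quotient-<⇒< s x y h = ≰⇒> λ y≤x → <⇒≱ h (/-monoˡ-≤ s y≤x)

    Below-contract : ∀ s .{{_ : NonZero s}} {j j' P a b} →
      Below j j' P (contract s a) (contract s b) → Below j j' P a b
    Below-contract s {a = []}    {b = []}    h       = h
    Below-contract s {a = x ∷ a} {b = y ∷ b} (p ∷ h) = (λ lt → quotient-<⇒< s x y (p lt)) ∷ h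
    Below-contract s {a = []}    {b = _ ∷ _} ()
    Below-contract s {a = _ ∷ _} {b = []}    ()

    lookup-increasing : ∀ {xs : List ℕ} → AllPairs _<_ xs → ∀ i j → toℕ i < toℕ j → lookup xs i < lookup xs j
    lookup-increasing (x< ∷ _)  zero    (suc j) _       = All.lookup x< (∈-lookup j)
    lookup-increasing (_ ∷ xs<) (suc i) (suc j) (s<s h) = lookup-increasing xs< i j h

    upTo-increasing : ∀ n → AllPairs _<_ (upTo n)
    upTo-increasing n = AllPairs.applyUpTo⁺₁ id n (λ i<j _ → i<j)

    -- One step of the Marcus–Tardos argument: cut the first axis into intervals of
    -- length s, merge each column of s cells, and move the merged axis to the end.
    -- A column holding more than κ points is wide; wide columns in the same slab with
    -- the same set of residues project to a set avoiding the lower-dimensional pattern.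
    contraction : (s q g : ℕ) .{{_ : NonZero s}} (π : Perm) (P : List Perm) (bs : List ℕ) (A : List Point) →
      Unique A → (∀ {a} → a ∈ A → InBox (q * s ∷ bs) a) → Avoids (π ∷ P) A →
      (∀ B → Unique B → (∀ {b} → b ∈ B → InBox bs b) → Avoids P B → length B ≤ g) →
      Σ (List Point) λ A' → Unique A' × (∀ {a} → a ∈ A' → InBox (bs ++ [ q ]) a) × Avoids (P ++ [ π ]) A' ×
        length A ≤ κ * length A' + s * (q * 2 ^ s * g)
    contraction s q g π P bs A A! A⊂ av IH = A' , A'! , A'⊂ , A'-av , bound
      where
      Q : List Point
      Q = deduplicate _≟ᵖ_ (map (contract s) A)

      A' : List Point
      A' = map rotate Q

      Q! : Unique Q
      Q! = UniqueDec.deduplicate-! _≟ᵖ_ (map (contract s) A)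

      A'! : Unique A'
      A'! = Unique.map⁺ (rotate-injective _ _) Q!

      ∈Q⁺ : ∀ {a} → a ∈ A → contract s a ∈ Q
      ∈Q⁺ a∈ = ∈-deduplicate⁺ _≟ᵖ_ (∈-map⁺ (contract s) a∈)

      ∈Q⁻ : ∀ {b} → b ∈ Q → ∃ λ a → a ∈ A × b ≡ contract s a
      ∈Q⁻ b∈ = ∈-map⁻ (contract s) (∈-deduplicate⁻ _≟ᵖ_ (map (contract s) A) b∈)

      Q⊂ : ∀ {b} → b ∈ Q → InBox (q ∷ bs) b
      Q⊂ b∈ with ∈Q⁻ b∈
      ... | a , a∈ , refl with A⊂ a∈
      ... | lt ∷ rest = m<n*o⇒m/o<n lt ∷ rest

      A'⊂ : ∀ {a} → a ∈ A' → InBox (bs ++ [ q ]) a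
      A'⊂ a∈ with ∈-map⁻ rotate a∈
      ... | b , b∈ , refl with Q⊂ b∈
      ... | lt ∷ rest = Pointwise.++⁺ rest (lt ∷ [])

      A'-av : Avoids (P ++ [ π ]) A'
      A'-av (f , f∈ , ord) = av ((λ j → proj₁ (pre j)) , (λ j → proj₁ (proj₂ (pre j))) , λ j j' →
        Below-contract s (Below-rotate P _ _
          (subst₂ (Below j j' (P ++ [ π ])) (proj₂ (proj₂ (pre j))) (proj₂ (proj₂ (pre j'))) (ord j j'))))
        where
        pre : ∀ j → ∃ λ a → a ∈ A × f j ≡ rotate (contract s a)
        pre j with ∈-map⁻ rotate (f∈ j)
        ... | b , b∈ , eq with ∈Q⁻ b∈
        ... | a , a∈ , refl = a , a∈ , eq

      expand : Point → ℕ → Point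
      expand []      r = []
      expand (x ∷ a) r = r + x * s ∷ a

      residues : Point → List ℕ
      residues b = filter (λ r → expand b r ∈? A) (upTo s)

      column : Point → List Point
      column b = map (expand b) (residues b)

      wide? : Decidable (λ b → suc κ ≤ length (residues b))
      wide? b = suc κ ≤? length (residues b)

      W : List Point
      W = filter wide? Q

      A⊆ : ∀ {a} → a ∈ A → a ∈ concatMap column Q
      A⊆ {a} a∈ with A⊂ a∈
      ... | _∷_ {x = x} {xs = xs} lt rest = ∈-concatMap column (∈Q⁺ a∈)
        (subst (_∈ column (x / s ∷ xs)) (cong (_∷ xs) (sym (m≡m%n+[m/n]*n x s)))
          (∈-map⁺ (expand (x / s ∷ xs)) (∈-filter⁺ _ (∈-upTo⁺ (m%n<n x s))
            (subst (_∈ A) (cong (_∷ xs) (m≡m%n+[m/n]*n x s)) a∈))))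

      key : Point → ℕ × List ℕ
      key b = head₀ b , residues b

      keys : List (ℕ × List ℕ)
      keys = concatMap (λ h → map (h ,_) (sublists (upTo s))) (upTo q)

      _≟ᵏ_ : DecidableEquality (ℕ × List ℕ)
      _≟ᵏ_ = ×-≡-dec _≟_ (≡-dec _≟_)

      key∈ : ∀ {b} → b ∈ W → key b ∈ keys
      key∈ b∈ with Q⊂ (proj₁ (∈-filter⁻ wide? b∈))
      ... | lt ∷ _ = ∈-concatMap _ (∈-upTo⁺ lt) (∈-map⁺ _ (filter∈sublists _ (upTo s)))

      length-keys : length keys ≤ q * 2 ^ s
      length-keys = ≤-trans
        (length-concatMap-≤ _ (2 ^ s) (upTo q) λ {h} _ → ≤-reflexive
          (trans (length-map (h ,_) (sublists (upTo s)))
          (trans (length-sublists (upTo s)) (cong (2 ^_) (length-upTo s)))))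
        (≤-reflexive (cong (_* 2 ^ s) (length-upTo q)))

      fibre : ∀ k → length (filter (λ b → key b ≟ᵏ k) W) ≤ g
      fibre (h , R) = subst (_≤ g) (length-map tail₀ F) (IH B B! B⊂ B-av)
        where
        F : List Point
        F = filter (λ b → key b ≟ᵏ (h , R)) W

        B : List Point
        B = map tail₀ F

        F⁻ : ∀ {b} → b ∈ F → b ∈ W × key b ≡ (h , R)
        F⁻ = ∈-filter⁻ (λ b → key b ≟ᵏ (h , R))

        F-shape : ∀ {b} → b ∈ F → b ≡ h ∷ tail₀ b
        F-shape b∈ with F⁻ b∈
        ... | b∈W , refl with Q⊂ (proj₁ (∈-filter⁻ wide? b∈W))
        ... | _ ∷ _ = refl

        B! : Unique B
        B! = map-unique tail₀ (Unique.filter⁺ _ (Unique.filter⁺ wide? Q!)) λ x∈ y∈ eq →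
          trans (F-shape x∈) (trans (cong (h ∷_) eq) (sym (F-shape y∈)))

        B⊂ : ∀ {b} → b ∈ B → InBox bs b
        B⊂ b∈ with ∈-map⁻ tail₀ b∈
        ... | c , c∈ , refl with Q⊂ (proj₁ (∈-filter⁻ wide? (proj₁ (F⁻ c∈))))
        ... | _ ∷ rest = rest

        B-av : Avoids P B
        B-av (f , f∈ , ord) = av (point , point∈ , λ j j' → lifts j j' ∷ ord j j')
          where
          pre : ∀ j → ∃ λ b → b ∈ F × f j ≡ tail₀ b
          pre j = ∈-map⁻ tail₀ (f∈ j)

          R≡ : R ≡ residues (h ∷ f zero)
          R≡ = let b , b∈ , eq = pre zero in
            trans (sym (proj₂ (,-injective (proj₂ (F⁻ b∈)))))
              (cong residues (trans (F-shape b∈) (cong (h ∷_) (sym eq))))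

          enough : suc κ ≤ length R
          enough = let b , b∈ , _ = pre zero in
            subst (λ z → suc κ ≤ length z) (proj₂ (,-injective (proj₂ (F⁻ b∈)))) (proj₂ (∈-filter⁻ wide? {xs = Q} (proj₁ (F⁻ b∈))))

          increasing : AllPairs _<_ R
          increasing = subst (AllPairs _<_) (sym R≡) (AllPairs.filter⁺ _ (upTo-increasing s))

          -- The residue of rank `π j` among the common residues `R`. All columns over the key
          -- contain every height of `R`, and `R` is increasing, so these heights realise `π` on the
          -- restored axis.
          at : Fin (suc κ) → ℕ
          at j = lookup R (inject≤ (V.lookup π j) enough)

          point : Fin (suc κ) → Point
          point j = at j + h * s ∷ f j

          point∈ : ∀ j → point j ∈ A
          point∈ j with pre j
          ... | b , b∈ , eq = proj₂ (∈-filter⁻ (λ r → expand (h ∷ f j) r ∈? A) {xs = upTo s}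
            (subst (at j ∈_)
              (trans (sym (proj₂ (,-injective (proj₂ (F⁻ b∈)))))
                (cong residues (trans (F-shape b∈) (cong (h ∷_) (sym eq)))))
              (∈-lookup (inject≤ (V.lookup π j) enough))))

          lifts : ∀ j j' → toℕ (V.lookup π j) < toℕ (V.lookup π j') → at j + h * s < at j' + h * s
          lifts j j' lt = +-monoˡ-< (h * s) (lookup-increasing increasing _ _
            (subst₂ _<_ (sym (toℕ-inject≤ (V.lookup π j) enough)) (sym (toℕ-inject≤ (V.lookup π j') enough)) lt))

      bound : length A ≤ κ * length A' + s * (q * 2 ^ s * g)
      bound = begin
        length A                             ≤⟨ length-⊆ A! A⊆ ⟩
        length (concatMap column Q)          ≤⟨ length-split wide? column κ s Q
                                                  (λ {b} _ → ≤-trans (≤-reflexive (length-map (expand b) (residues b)))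
                                                    (≤-trans (length-filter _ (upTo s)) (≤-reflexive (length-upTo s))))
                                                  (λ {b} _ ¬w → ≤-trans (≤-reflexive (length-map (expand b) (residues b))) (≤-pred (≰⇒> ¬w))) ⟩
        κ * length Q + s * length W          ≤⟨ +-mono-≤ (≤-reflexive (cong (κ *_) (sym (length-map rotate Q))))
                                                  (*-monoʳ-≤ s (≤-trans
                                                    (length-fibres _≟ᵏ_ key g (Unique.filter⁺ wide? Q!) key∈ fibre)
                                                    (*-monoˡ-≤ g length-keys))) ⟩
        κ * length A' + s * (q * 2 ^ s * g)  ∎
        where open ≤-Reasoning

  -- The linear extremal bound: induction on dimension and side

  module Extremal {κ : ℕ} where

    open Pattern {κ}

    -- Coefficient of `q * g` after `i` rounds: a round multiplies the error of the later rounds by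
    -- κ and adds its own `s * 2 ^ s`, for at most `q * 2 ^ s * g` wide columns of at most `s`
    -- points.
    roundConstant : ℕ → ℕ → ℕ
    roundConstant s zero    = 0
    roundConstant s (suc i) = κ * roundConstant s i + s * 2 ^ s

    replicate-snoc : ∀ j (q : ℕ) → replicate j q ++ [ q ] ≡ replicate (suc j) q
    replicate-snoc zero    q = refl
    replicate-snoc (suc j) q = cong (q ∷_) (replicate-snoc j q)

    InBox-weaken : ∀ i j {p q a} → q ≤ p → InBox (replicate i p ++ replicate j q) a → InBox (replicate (i + j) p) a
    InBox-weaken zero    zero    q≤p []      = []
    InBox-weaken zero    (suc j) q≤p (x ∷ h) = <-≤-trans x q≤p ∷ InBox-weaken zero j q≤p h
    InBox-weaken (suc i) j       q≤p (x ∷ h) = x ∷ InBox-weaken i j q≤p h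

    Bounds : ℕ → ℕ → ℕ → Set
    Bounds D n g = ∀ P A → length P ≡ D → Unique A → (∀ {a} → a ∈ A → InBox (replicate D n) a) → Avoids P A → length A ≤ g

    -- Between rounds the box is no cube, so the bound of one dimension less is applied after
    -- enlarging all remaining sides to `q * s`. The rotated pattern `P'` is left existential, since
    -- `Bounds` quantifies over all patterns.
    rounds : ∀ s .{{_ : NonZero s}} q g e → Bounds e (q * s) g →
      ∀ i j P A → length P ≡ suc e → i + j ≡ suc e → Unique A →
      (∀ {a} → a ∈ A → InBox (replicate i (q * s) ++ replicate j q) a) → Avoids P A →
      ∃₂ λ P' A' → length P' ≡ suc e × Unique A' × (∀ {a} → a ∈ A' → InBox (replicate (suc e) q) a) × Avoids P' A' ×
        length A ≤ κ ^ i * length A' + roundConstant s i * (q * g)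
    rounds s q g e IH zero    j P A lP refl A! A⊂ av = P , A , lP , A! , A⊂ , av , ≤-reflexive (sym (trans (+-identityʳ _) (+-identityʳ _)))
    rounds s q g e IH (suc i) j (π ∷ P) A lP ij A! A⊂ av
      with contraction s q g π P (replicate i (q * s) ++ replicate j q) A A! A⊂ av
        (λ B B! B⊂ B-av → IH P B (suc-injective lP) B!
          (λ b∈ → subst (λ k → InBox (replicate k (q * s)) _) (suc-injective ij) (InBox-weaken i j (m≤m*n q s) (B⊂ b∈))) B-av)
    ... | A₁ , A₁! , A₁⊂ , A₁-av , b₁
      with rounds s q g e IH i (suc j) (P ++ [ π ]) A₁ (trans (length-snoc P π) lP) (trans (+-suc i j) ij) A₁!
        (λ a∈ → subst (λ bs → InBox bs _)
          (trans (++-assoc (replicate i (q * s)) (replicate j q) [ q ]) (cong (replicate i (q * s) ++_) (replicate-snoc j q)))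
          (A₁⊂ a∈)) A₁-av
    ... | P' , A' , lP' , A'! , A'⊂ , A'-av , b₂ = P' , A' , lP' , A'! , A'⊂ , A'-av , bound
      where
      open ≤-Reasoning
      arith : ∀ k p x r c q t g → k * (p * x + r * (q * g)) + c * (q * t * g) ≡ k * p * x + (k * r + c * t) * (q * g)
      arith = solve-∀
      bound : length A ≤ κ ^ suc i * length A' + roundConstant s (suc i) * (q * g)
      bound = begin
        length A                                   ≤⟨ b₁ ⟩
        κ * length A₁ + s * (q * 2 ^ s * g)        ≤⟨ +-monoˡ-≤ _ (*-monoʳ-≤ κ b₂) ⟩
        κ * (κ ^ i * length A' + roundConstant s i * (q * g)) + s * (q * 2 ^ s * g)
                                                   ≡⟨ arith κ (κ ^ i) (length A') (roundConstant s i) s q (2 ^ s) g ⟩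
        κ ^ suc i * length A' + roundConstant s (suc i) * (q * g) ∎

    origin : ∀ D {a} → InBox (replicate D 1) a → a ≡ replicate D 0
    origin zero    []        = refl
    origin (suc D) (z<s ∷ h) = cong (0 ∷_) (origin D h)

    unit-box : ∀ D A → Unique A → (∀ {a} → a ∈ A → InBox (replicate D 1) a) → length A ≤ 1
    unit-box D A A! A⊂ = length-⊆ {ys = [ replicate D 0 ]} A! λ a∈ → here (origin D (A⊂ a∈))

    -- Contraction with `s = n` and `q = 1` makes the whole line one column. Its wide-column term
    -- vanishes with `g = 0`, because a nonempty set in dimension zero contains the empty pattern.
    linear : ∀ n .{{_ : NonZero n}} → Bounds 1 n κ
    linear n (π ∷ []) A refl A! A⊂ av
      with contraction n 1 0 π [] [] A A! (λ a∈ → subst (λ k → InBox (k ∷ []) _) (sym (*-identityˡ n)) (A⊂ a∈)) av empty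
      where
      empty : ∀ B → Unique B → (∀ {b} → b ∈ B → InBox [] b) → Avoids [] B → length B ≤ 0
      empty []      _ _  _  = z≤n
      empty (b ∷ B) _ B⊂ av with B⊂ (here refl)
      ... | [] = contradiction ((λ _ → []) , (λ _ → here refl) , λ _ _ → []) av
    ... | A' , A'! , A'⊂ , _ , b = begin
      length A                                ≤⟨ b ⟩
      κ * length A' + n * (1 * 2 ^ n * 0)     ≡⟨ arith κ (length A') n (2 ^ n) ⟩
      κ * length A'                           ≤⟨ *-monoʳ-≤ κ (unit-box 1 A' A'! A'⊂) ⟩
      κ * 1                                   ≡⟨ *-identityʳ κ ⟩
      κ                                       ∎
      where
      open ≤-Reasoning
      arith : ∀ k x n t → k * x + n * (1 * t * 0) ≡ k * x
      arith = solve-∀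

    -- `large` says that a full turn of rounds loses less than it gains: the factor `κ ^ (2 + e)`
    -- lost in dimension `2 + e` stays strictly below the growth `s ^ (1 + e)` of the target bound
    -- when the side is multiplied by `s`.
    module _ (s : ℕ) .{{_ : NonZero s}} (large : ∀ e → κ ^ (2 + e) < s ^ (1 + e)) where

      -- The product is the coefficient of the wide-column terms, which are absorbed by the unit
      -- that the strict inequality `large` leaves over. The `suc` keeps the constant positive, as
      -- the one-point box requires.
      extremalConstant : ℕ → ℕ
      extremalConstant zero    = κ
      extremalConstant (suc e) = suc (roundConstant s (2 + e) * extremalConstant e * s ^ e)

      extremal : ∀ e j → Bounds (suc e) (s ^ j) (extremalConstant e * (s ^ j) ^ e)
      extremal zero    j       P A lP A! A⊂ av = subst (length A ≤_) (sym (*-identityʳ κ)) (linear (s ^ j) {{m^n≢0 s j}} P A lP A! A⊂ av)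
      extremal (suc e) zero    P A lP A! A⊂ av = begin
        length A                                ≤⟨ unit-box (2 + e) A A! A⊂ ⟩
        1                                       ≤⟨ s≤s z≤n ⟩
        extremalConstant (suc e)                ≡⟨ trans (cong (extremalConstant (suc e) *_) (^-zeroˡ (suc e))) (*-identityʳ _) ⟨
        extremalConstant (suc e) * 1 ^ suc e    ∎
        where open ≤-Reasoning
      extremal (suc e) (suc j) P A lP A! A⊂ av
        with rounds s (s ^ j) (extremalConstant e * (s ^ suc j) ^ e) (suc e)
          (subst (λ n → Bounds (suc e) n (extremalConstant e * (s ^ suc j) ^ e)) (*-comm s (s ^ j)) (extremal e (suc j)))
          (2 + e) 0 P A lP (cong (2 +_) (+-identityʳ e)) A!
          (λ {a} a∈ → subst (λ bs → InBox bs a) (trans (cong (replicate (2 + e)) (*-comm s (s ^ j))) (sym (++-identityʳ _))) (A⊂ a∈)) av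
      ... | P' , A' , lP' , A'! , A'⊂ , A'-av , b = begin
        length A
          ≤⟨ b ⟩
        κ ^ (2 + e) * length A' + K * (q * (C' * (s * q) ^ e))
          ≤⟨ +-monoˡ-≤ _ (*-monoʳ-≤ (κ ^ (2 + e)) (extremal (suc e) j P' A' lP' A'! A'⊂ A'-av)) ⟩
        κ ^ (2 + e) * (C * q ^ suc e) + K * (q * (C' * (s * q) ^ e))
          ≡⟨ cong (λ z → κ ^ (2 + e) * (C * q ^ suc e) + K * (q * (C' * z))) (^-distribʳ-* e s q) ⟩
        κ ^ (2 + e) * (C * q ^ suc e) + K * (q * (C' * (s ^ e * q ^ e)))
          ≡⟨ cong (κ ^ (2 + e) * (C * q ^ suc e) +_) (arith K q C' (s ^ e) (q ^ e)) ⟩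
        κ ^ (2 + e) * (C * q ^ suc e) + K * C' * s ^ e * q ^ suc e
          ≤⟨ +-monoʳ-≤ (κ ^ (2 + e) * (C * q ^ suc e)) (*-monoˡ-≤ (q ^ suc e) (n≤1+n (K * C' * s ^ e))) ⟩
        κ ^ (2 + e) * (C * q ^ suc e) + C * q ^ suc e
          ≡⟨ +-comm (κ ^ (2 + e) * (C * q ^ suc e)) _ ⟩
        suc (κ ^ (2 + e)) * (C * q ^ suc e)
          ≤⟨ *-monoˡ-≤ (C * q ^ suc e) (large e) ⟩
        s ^ suc e * (C * q ^ suc e)
          ≡⟨ arith' (s ^ suc e) C (q ^ suc e) ⟩
        C * (s ^ suc e * q ^ suc e)
          ≡⟨ cong (C *_) (^-distribʳ-* (suc e) s q) ⟨
        C * (s * q) ^ suc e ∎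
        where
        open ≤-Reasoning
        q K C C' : ℕ
        q  = s ^ j
        K  = roundConstant s (2 + e)
        C  = extremalConstant (suc e)
        C' = extremalConstant e
        arith : ∀ K q C' u v → K * (q * (C' * (u * v))) ≡ K * C' * u * (q * v)
        arith = solve-∀
        arith' : ∀ u C v → u * (C * v) ≡ C * (u * v)
        arith' = solve-∀

  -- Reflecting the Boolean definitions

  all-true : (p : X → Bool) (xs : List X) → (∀ x → p x ≡ true) → all p xs ≡ true
  all-true p []       h = refl
  all-true p (x ∷ xs) h rewrite h x = all-true p xs h

  all-∈ : (p : X → Bool) {xs : List X} {x : X} → all p xs ≡ true → x ∈ xs → p x ≡ true
  all-∈ p {x ∷ xs} h x∈ with p x in eq
  all-∈ p {x ∷ xs} h (here refl) | true = eq
  all-∈ p {x ∷ xs} h (there x∈)  | true = all-∈ p h x∈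

  any-true : (p : X → Bool) {xs : List X} {x : X} → x ∈ xs → p x ≡ true → any p xs ≡ true
  any-true p {x ∷ xs} (here refl) h rewrite h = refl
  any-true p {x ∷ xs} (there x∈)  h with p x
  ... | true  = refl
  ... | false = any-true p x∈ h

  any-false : (p : X → Bool) (xs : List X) → (∀ x → p x ≢ true) → any p xs ≡ false
  any-false p []       h = refl
  any-false p (x ∷ xs) h with p x in eq
  ... | true  = contradiction eq (h x)
  ... | false = any-false p xs h

  <ᵇ-true : ∀ {m n} → m < n → (m <ᵇ n) ≡ true
  <ᵇ-true lt = Equivalence.to T-≡ (<⇒<ᵇ lt)

  <ᵇ-true⁻¹ : ∀ {m n} → (m <ᵇ n) ≡ true → m < n
  <ᵇ-true⁻¹ {m} {n} eq = <ᵇ⇒< m n (Equivalence.from T-≡ eq)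

  <ᵇ-false : ∀ {m n} → ¬ m < n → (m <ᵇ n) ≡ false
  <ᵇ-false {m} {n} h with m <ᵇ n in eq
  ... | true  = contradiction (<ᵇ-true⁻¹ eq) h
  ... | false = refl

  ∧-true : ∀ {x y} → x ≡ true → y ≡ true → (x ∧ y) ≡ true
  ∧-true refl refl = refl

  ∧-true⁻¹ : ∀ {x y} → (x ∧ y) ≡ true → x ≡ true × y ≡ true
  ∧-true⁻¹ {true} {true} _ = refl , refl

  ==⁻¹ : ∀ {x y} → (x == y) ≡ true → x ≡ y
  ==⁻¹ {true}  {true}  _ = refl
  ==⁻¹ {false} {false} _ = refl

  Injective : ∀ {n} → Vec X n → Set
  Injective v = ∀ i j → V.lookup v i ≡ V.lookup v j → i ≡ j

  isPermB⇒Injective : ∀ {n} (v : Vec (Fin n) n) → isPermB v ≡ true → Injective v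
  isPermB⇒Injective {n} v h i j eq = conclude (all-∈ (λ j → (i =F j) ∨ not (V.lookup v i =F V.lookup v j))
    (all-∈ (λ i → all (λ j → (i =F j) ∨ not (V.lookup v i =F V.lookup v j)) (allFin n)) h (∈-allFin i)) (∈-allFin j))
    where
    conclude : ((i =F j) ∨ not (V.lookup v i =F V.lookup v j)) ≡ true → i ≡ j
    conclude t with toℕ i ≡ᵇ toℕ j in e
    ... | true  = toℕ-injective (≡ᵇ⇒≡ _ _ (Equivalence.from T-≡ e))
    ... | false rewrite Equivalence.to T-≡ (≡⇒≡ᵇ (toℕ (V.lookup v i)) _ (cong toℕ eq)) = contradiction t λ ()

  Injective⇒isPermB : ∀ {n} (v : Vec (Fin n) n) → Injective v → isPermB v ≡ true
  Injective⇒isPermB {n} v inj = all-true _ (allFin n) λ i → all-true _ (allFin n) λ j → test i j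
    where
    test : ∀ i j → ((i =F j) ∨ not (V.lookup v i =F V.lookup v j)) ≡ true
    test i j with toℕ i ≡ᵇ toℕ j in e₁ | toℕ (V.lookup v i) ≡ᵇ toℕ (V.lookup v j) in e₂
    ... | true  | _     = refl
    ... | false | false = refl
    ... | false | true  = trans (sym e₁) (Equivalence.to T-≡ (≡⇒≡ᵇ (toℕ i) (toℕ j)
      (cong toℕ (inj i j (toℕ-injective (≡ᵇ⇒≡ _ _ (Equivalence.from T-≡ e₂)))))))

  ∈-filterᵇ⁺ : (p : X → Bool) {xs : List X} {x : X} → x ∈ xs → p x ≡ true → x ∈ filterᵇ p xs
  ∈-filterᵇ⁺ p x∈ h = ∈-filter⁺ (T? ∘ p) x∈ (Equivalence.from T-≡ h)

  ∈-filterᵇ⁻ : (p : X → Bool) {xs : List X} {x : X} → x ∈ filterᵇ p xs → x ∈ xs × p x ≡ true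
  ∈-filterᵇ⁻ p x∈ = let y , t = ∈-filter⁻ (T? ∘ p) x∈ in y , Equivalence.to T-≡ t

  ∈-allVecs : ∀ {k} {xs : List X} (v : Vec X k) → (∀ i → V.lookup v i ∈ xs) → v ∈ allVecs k xs
  ∈-allVecs []      h = here refl
  ∈-allVecs (x ∷ v) h = ∈-concatMap _ (h zero) (∈-map⁺ (x ∷_) (∈-allVecs v (h ∘ suc)))

  allVecs-unique : ∀ k {xs : List X} → Unique xs → Unique (allVecs k xs)
  allVecs-unique zero    xs! = [] ∷ []
  allVecs-unique (suc k) {xs} xs! = subst Unique (expand xs)
    (Unique.cartesianProductWith⁺ _∷_ V.∷-injective xs! (allVecs-unique k xs!))
    where
    expand : ∀ ys → cartesianProductWith _∷_ ys (allVecs k xs) ≡ concatMap (λ x → map (x ∷_) (allVecs k xs)) ys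
    expand []       = refl
    expand (y ∷ ys) = cong (map (y ∷_) (allVecs k xs) ++_) (expand ys)

  length-concatMap-map : (f : X → Y → Z) (xs : List X) (ys : List Y) →
    length (concatMap (λ x → map (f x) ys) xs) ≡ length xs * length ys
  length-concatMap-map f []       ys = refl
  length-concatMap-map f (x ∷ xs) ys = trans (length-++ (map (f x) ys))
    (cong₂ _+_ (length-map (f x) ys) (length-concatMap-map f xs ys))

  length-allVecs : ∀ k (xs : List X) → length (allVecs k xs) ≡ length xs ^ k
  length-allVecs zero    xs = refl
  length-allVecs (suc k) xs = trans (length-concatMap-map _∷_ xs (allVecs k xs)) (cong (length xs *_) (length-allVecs k xs))

  perms-unique : ∀ n → Unique (perms n)
  perms-unique n = Unique.filter⁺ (T? ∘ isPermB) (allVecs-unique n (Unique.allFin⁺ n))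

  ∈-perms : ∀ {n} (v : Vec (Fin n) n) → Injective v → v ∈ perms n
  ∈-perms {n} v inj = ∈-filterᵇ⁺ isPermB (∈-allVecs v λ i → ∈-allFin _) (Injective⇒isPermB v inj)

  Occurs : ∀ {m n d} → Vec (Vec (Fin m) m) d → Vec (Vec (Fin n) n) d → (Fin m → Fin n) → Set
  Occurs σs τs c = (∀ j k → toℕ j < toℕ k → toℕ (c j) < toℕ (c k)) ×
    (∀ i j k → toℕ (V.lookup (V.lookup σs i) j) < toℕ (V.lookup (V.lookup σs i) k) →
               toℕ (V.lookup (V.lookup τs i) (c j)) < toℕ (V.lookup (V.lookup τs i) (c k)))

  module _ {m n d : ℕ} (σs : Vec (Vec (Fin m) m) d) (τs : Vec (Vec (Fin n) n) d) where

    -- By trichotomy on the entries of each pattern permutation the one-sided condition already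
    -- gives equality of the Boolean tests: in the remaining case of equal entries, injectivity
    -- makes the indices equal.
    Occurs⇒containsParB : (∀ i → Injective (V.lookup σs i)) → ∀ c → Occurs σs τs c → containsParB σs τs ≡ true
    Occurs⇒containsParB inj c (inc , ord) = any-true _ {x = V.tabulate c} (∈-allVecs (V.tabulate c) λ i → ∈-allFin _)
      (∧-true (all-true _ (allFin m) λ j → all-true _ (allFin m) (increasing j))
              (all-true _ (allFin d) λ i → all-true _ (allFin m) λ j → all-true _ (allFin m) (iso i j)))
      where
      increasing : ∀ j k → (not (j <F k) ∨ (V.lookup (V.tabulate c) j <F V.lookup (V.tabulate c) k)) ≡ true
      increasing j k rewrite V.lookup∘tabulate c j | V.lookup∘tabulate c k with toℕ j <ᵇ toℕ k in e
      ... | false = refl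
      ... | true  = <ᵇ-true (inc j k (<ᵇ-true⁻¹ e))

      iso : ∀ i j k → ((V.lookup (V.lookup τs i) (V.lookup (V.tabulate c) j) <F V.lookup (V.lookup τs i) (V.lookup (V.tabulate c) k))
                        == (V.lookup (V.lookup σs i) j <F V.lookup (V.lookup σs i) k)) ≡ true
      iso i j k rewrite V.lookup∘tabulate c j | V.lookup∘tabulate c k
        with <-cmp (toℕ (V.lookup (V.lookup σs i) j)) (toℕ (V.lookup (V.lookup σs i) k))
      ... | tri< lt _ _ rewrite <ᵇ-true lt | <ᵇ-true (ord i j k lt) = refl
      ... | tri> ¬lt _ gt rewrite <ᵇ-false ¬lt | <ᵇ-false (<-asym (ord i k j gt)) = refl
      ... | tri≈ ¬lt eq _ with inj i j k (toℕ-injective eq)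
      ... | refl rewrite <ᵇ-false ¬lt | <ᵇ-false (<-irrefl {toℕ (V.lookup (V.lookup τs i) (c j))} refl) = refl

    containsParB-false : (∀ c → (∀ j k → toℕ j < toℕ k → toℕ (c j) < toℕ (c k)) →
        ¬ (∀ i j k → (V.lookup (V.lookup τs i) (c j) <F V.lookup (V.lookup τs i) (c k))
                      ≡ (V.lookup (V.lookup σs i) j <F V.lookup (V.lookup σs i) k))) →
      containsParB σs τs ≡ false
    containsParB-false h = any-false _ (allVecs m (allFin n)) λ c t → let inc , ord = ∧-true⁻¹ t in
      h (V.lookup c)
        (λ j k lt → increasing c j k lt (all-∈ _ (all-∈ _ inc (∈-allFin j)) (∈-allFin k)))
        (λ i j k → ==⁻¹ (all-∈ _ (all-∈ _ (all-∈ _ ord (∈-allFin i)) (∈-allFin j)) (∈-allFin k)))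
      where
      increasing : ∀ c j k → toℕ j < toℕ k → (not (j <F k) ∨ (V.lookup c j <F V.lookup c k)) ≡ true → toℕ (V.lookup c j) < toℕ (V.lookup c k)
      increasing c j k lt t rewrite <ᵇ-true lt = <ᵇ-true⁻¹ t

  -- The upper bound

  choices : ∀ {n} → (Fin n → List X) → List (Vec X n)
  choices {n = zero}  o = [ [] ]
  choices {n = suc n} o = concatMap (λ x → map (x ∷_) (choices (o ∘ suc))) (o zero)

  length-choices : ∀ {n} (o : Fin n → List X) b → (∀ i → length (o i) ≤ b) → length (choices o) ≤ b ^ n
  length-choices {n = zero}  o b h = ≤-refl
  length-choices {n = suc n} o b h = ≤-trans (≤-reflexive (length-concatMap-map _∷_ (o zero) (choices (o ∘ suc))))
    (*-mono-≤ (h zero) (length-choices (o ∘ suc) b (h ∘ suc)))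

  ∈-choices : ∀ {n} (o : Fin n → List X) f → (∀ i → f i ∈ o i) → V.tabulate f ∈ choices o
  ∈-choices {n = zero}  o f h = here refl
  ∈-choices {n = suc n} o f h = ∈-concatMap _ (h zero) (∈-map⁺ (f zero ∷_) (∈-choices (o ∘ suc) (f ∘ suc) (h ∘ suc)))

  -- Few candidate lists for all avoiding sets

  module Covering {κ : ℕ} where

    open Pattern {κ}
    open Extremal {κ}
    open import Data.List.Membership.DecPropositional _≟ᵖ_ using (_∈?_)

    children : (w D : ℕ) → Point → List Point
    children w zero    _       = [ [] ]
    children w (suc D) []      = []
    children w (suc D) (x ∷ a) = concatMap (λ r → map (r + x * w ∷_) (children w D a)) (upTo w)

    length-children : ∀ w D a → length (children w D a) ≤ w ^ D
    length-children w zero    a       = ≤-refl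
    length-children w (suc D) []      = z≤n
    length-children w (suc D) (x ∷ a) = ≤-trans
      (length-concatMap-≤ _ (w ^ D) (upTo w) λ {r} _ →
        ≤-trans (≤-reflexive (length-map _ (children w D a))) (length-children w D a))
      (≤-reflexive (cong (_* w ^ D) (length-upTo w)))

    module _ (w : ℕ) .{{_ : NonZero w}} where

      quotient : Point → Point
      quotient = map (_/ w)

      ∈-children : ∀ a → a ∈ children w (length a) (quotient a)
      ∈-children []      = here refl
      ∈-children (x ∷ a) = ∈-concatMap _ (∈-upTo⁺ (m%n<n x w))
        (subst (λ y → (x ∷ a) ∈ map (y ∷_) (children w (length a) (quotient a))) (m≡m%n+[m/n]*n x w)
          (∈-map⁺ (x ∷_) (∈-children a)))

      Below-quotient : ∀ {j j' P} a b → Below j j' P (quotient a) (quotient b) → Below j j' P a b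
      Below-quotient []      []      []      = []
      Below-quotient (x ∷ a) (y ∷ b) (p ∷ h) = (λ lt → quotient-<⇒< w x y (p lt)) ∷ Below-quotient a b h

      InBox-quotient : ∀ D {n a} → InBox (replicate D (n * w)) a → InBox (replicate D n) (quotient a)
      InBox-quotient zero    []      = []
      InBox-quotient (suc D) (x ∷ h) = m<n*o⇒m/o<n x ∷ InBox-quotient D h

      Avoids-quotient : ∀ {P A} → Avoids P A → Avoids P (map quotient A)
      Avoids-quotient {P} av (f , f∈ , ord) =
        av ((λ j → proj₁ (pre j)) , (λ j → proj₁ (proj₂ (pre j))) , λ j j' →
          Below-quotient _ _ (subst₂ (Below j j' P) (proj₂ (proj₂ (pre j))) (proj₂ (proj₂ (pre j'))) (ord j j')))
        where
        pre : ∀ j → ∃ λ a → a ∈ _ × f j ≡ quotient a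
        pre j = ∈-map⁻ quotient (f∈ j)

    module _ (s : ℕ) .{{_ : NonZero s}} (large : ∀ e → κ ^ (2 + e) < s ^ (1 + e)) (d : ℕ) where

      c : ℕ
      c = extremalConstant s large d

      -- `take` enforces the size bound on every list of the family, also on those that describe no
      -- avoiding set.
      refine : ℕ → List Point → List Point
      refine j L = concatMap (children s (suc d)) (take (c * (s ^ j) ^ d) (deduplicate _≟ᵖ_ L))

      -- Klazar's recursion: every set avoiding a pattern in a box of side s ^ j has, up to
      -- order and repetition, the same elements as some member of family j.
      family : ℕ → List (List Point)
      family zero    = sublists [ replicate (suc d) 0 ]
      family (suc j) = concatMap (sublists ∘ refine j) (family j)

      length-refine : ∀ j L → length (refine j L) ≤ c * (s ^ j) ^ d * s ^ suc d
      length-refine j L = ≤-trans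
        (length-concatMap-≤ (children s (suc d)) (s ^ suc d) (take (c * (s ^ j) ^ d) (deduplicate _≟ᵖ_ L)) λ {a} _ → length-children s (suc d) a)
        (*-monoˡ-≤ (s ^ suc d) (length-take-≤ (c * (s ^ j) ^ d) (deduplicate _≟ᵖ_ L)))

      -- Chosen so that one step of the recursion at most doubles the exponent of 2; the bound
      -- `2 ≤ s ^ d` pays for this, so the exponent stays proportional to `(s ^ j) ^ d`.
      familyConstant : ℕ
      familyConstant = suc (c * s ^ suc d)

      length-family : 2 ≤ s ^ d → ∀ j → length (family j) ≤ 2 ^ (familyConstant * (s ^ j) ^ d)
      length-family 2≤ zero    = ^-monoʳ-≤ 2 {1} (≤-trans (s≤s z≤n) (≤-reflexive
        (sym (trans (cong (familyConstant *_) (^-zeroˡ d)) (*-identityʳ familyConstant)))))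
      length-family 2≤ (suc j) = begin
        length (family (suc j))
          ≤⟨ length-concatMap-≤ _ (2 ^ (c * x * s ^ suc d)) (family j) (λ {L} _ →
               ≤-trans (≤-reflexive (length-sublists (refine j L))) (^-monoʳ-≤ 2 (length-refine j L))) ⟩
        length (family j) * 2 ^ (c * x * s ^ suc d)
          ≤⟨ *-monoˡ-≤ _ (length-family 2≤ j) ⟩
        2 ^ (familyConstant * x) * 2 ^ (c * x * s ^ suc d)
          ≡⟨ ^-distribˡ-+-* 2 (familyConstant * x) _ ⟨
        2 ^ (familyConstant * x + c * x * s ^ suc d)
          ≤⟨ ^-monoʳ-≤ 2 exponent ⟩
        2 ^ (familyConstant * (s ^ suc j) ^ d) ∎
        where
        open ≤-Reasoning
        x : ℕ
        x = (s ^ j) ^ d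
        arith : ∀ c x t → suc (c * t) * x + c * x * t + x ≡ 2 * (suc (c * t) * x)
        arith = solve-∀
        arith' : ∀ t k x → t * (k * x) ≡ k * (t * x)
        arith' = solve-∀
        exponent : familyConstant * x + c * x * s ^ suc d ≤ familyConstant * (s ^ suc j) ^ d
        exponent = begin
          familyConstant * x + c * x * s ^ suc d      ≤⟨ m≤m+n _ x ⟩
          familyConstant * x + c * x * s ^ suc d + x  ≡⟨ arith c x (s ^ suc d) ⟩
          2 * (familyConstant * x)                    ≤⟨ *-monoˡ-≤ (familyConstant * x) 2≤ ⟩
          s ^ d * (familyConstant * x)                ≡⟨ arith' (s ^ d) familyConstant x ⟩
          familyConstant * (s ^ d * x)                ≡⟨ cong (familyConstant *_) (^-distribʳ-* d s (s ^ j)) ⟨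
          familyConstant * (s ^ suc j) ^ d            ∎

      -- The cells of side `s` met by `A` avoid the pattern too, so the previous family lists them.
      -- `A` lies among the children of these cells, and as a filter of that list it is one of its
      -- sublists.
      covered : ∀ P → length P ≡ suc d → ∀ j A → (∀ {a} → a ∈ A → InBox (replicate (suc d) (s ^ j)) a) → Avoids P A →
        ∃ λ L → L ∈ family j × (∀ {a} → a ∈ A → a ∈ L) × (∀ {a} → a ∈ L → a ∈ A)
      covered P lP zero    A A⊂ av = filter (_∈? A) [ replicate (suc d) 0 ] , filter∈sublists (_∈? A) _ ,
        (λ a∈ → ∈-filter⁺ (_∈? A) (here (origin (suc d) (A⊂ a∈))) a∈) ,
        λ a∈ → proj₂ (∈-filter⁻ (_∈? A) {xs = [ replicate (suc d) 0 ]} a∈)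
      covered P lP (suc j) A A⊂ av
        with covered P lP j (map (quotient s) A)
          (λ a∈ → let a' , a'∈ , eq = ∈-map⁻ (quotient s) a∈ in
            subst (InBox (replicate (suc d) (s ^ j))) (sym eq)
              (InBox-quotient s (suc d) (subst (λ n → InBox (replicate (suc d) n) a') (*-comm s (s ^ j)) (A⊂ a'∈))))
          (Avoids-quotient s av)
      ... | L , L∈ , A⊆L , L⊆A = filter (_∈? A) (refine j L) ,
        ∈-concatMap (sublists ∘ refine j) L∈ (filter∈sublists (_∈? A) (refine j L)) ,
        (λ a∈ → ∈-filter⁺ (_∈? A) (A⊆ a∈) a∈) ,
        λ a∈ → proj₂ (∈-filter⁻ (_∈? A) {xs = refine j L} a∈)
        where
        L' : List Point
        L' = deduplicate _≟ᵖ_ L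

        L'⊆A : ∀ {a} → a ∈ L' → a ∈ map (quotient s) A
        L'⊆A a∈ = L⊆A (∈-deduplicate⁻ _≟ᵖ_ L a∈)

        -- Every element of `L'` is an occupied cell, so `L'` avoids the pattern as well. Here the
        -- extremal bound shows that `take` removes nothing.
        small : length L' ≤ c * (s ^ j) ^ d
        small = extremal s large d j P L' lP (UniqueDec.deduplicate-! _≟ᵖ_ L)
          (λ a∈ → let a' , a'∈ , eq = ∈-map⁻ (quotient s) (L'⊆A a∈) in
            subst (InBox (replicate (suc d) (s ^ j))) (sym eq)
              (InBox-quotient s (suc d) (subst (λ n → InBox (replicate (suc d) n) a') (*-comm s (s ^ j)) (A⊂ a'∈))))
          (λ (f , f∈ , ord) → Avoids-quotient s av (f , (λ i → L'⊆A (f∈ i)) , ord))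

        A⊆ : ∀ {a} → a ∈ A → a ∈ refine j L
        A⊆ {a} a∈ = ∈-concatMap (children s (suc d))
          (subst (quotient s a ∈_) (sym (take-all _ L' small)) (∈-deduplicate⁺ _≟ᵖ_ (A⊆L (∈-map⁺ (quotient s) a∈))))
          (subst (λ D → a ∈ children s D (quotient s a))
            (trans (Pointwise.Pointwise-length (A⊂ a∈)) (length-replicate (suc d))) (∈-children s a))

  -- Avoiding tuples counted through their occupied cells

  module UpperCount {κ : ℕ} (s : ℕ) .{{_ : NonZero s}} (large : ∀ e → κ ^ (2 + e) < s ^ (1 + e)) {d : ℕ}
    (σs : Vec (Vec (Fin (suc κ)) (suc κ)) d) (σs-inj : ∀ i → Injective (V.lookup σs i))
    (n j w : ℕ) .{{_ : NonZero w}} (n≤ : n ≤ s ^ j * w) where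

    open Pattern {κ}
    open Covering {κ}

    -- The leading identity permutation expresses that the positions of an occurrence increase.
    pattern₀ : List Perm
    pattern₀ = V.allFin (suc κ) ∷ V.toList σs

    Tuple : Set
    Tuple = Vec (Vec (Fin n) n) d

    row : Tuple → Fin n → Point
    row τs c = V.toList (V.map (λ τ → toℕ (V.lookup τ c)) τs)

    length-row : ∀ τs c → length (row τs c) ≡ d
    length-row τs c = V.length-toList (V.map (λ τ → toℕ (V.lookup τ c)) τs)

    cell : Tuple → Fin n → Point
    cell τs c = quotient w (toℕ c ∷ row τs c)

    cells : Tuple → List Point
    cells τs = map (cell τs) (allFin n)

    cells⊂ : ∀ τs {a} → a ∈ cells τs → InBox (replicate (suc d) (s ^ j)) a
    cells⊂ τs a∈ with ∈-map⁻ (cell τs) a∈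
    ... | c , _ , refl = InBox-quotient w (suc d) (<-≤-trans (toℕ<n c) n≤ ∷ rows τs)
      where
      rows : ∀ {d} (τs : Vec (Vec (Fin n) n) d) → InBox (replicate d (s ^ j * w)) (V.toList (V.map (λ τ → toℕ (V.lookup τ c)) τs))
      rows []       = []
      rows (τ ∷ τs) = <-≤-trans (toℕ<n (V.lookup τ c)) n≤ ∷ rows τs

    Below-lookup : ∀ {d} (σs : Vec Perm d) (f g : Vec (Fin n) n → ℕ) (τs : Vec (Vec (Fin n) n) d) {i i'} →
      Below i i' (V.toList σs) (V.toList (V.map f τs)) (V.toList (V.map g τs)) →
      ∀ t → toℕ (V.lookup (V.lookup σs t) i) < toℕ (V.lookup (V.lookup σs t) i') → f (V.lookup τs t) < g (V.lookup τs t)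
    Below-lookup (_ ∷ _)  f g (_ ∷ _)  (p ∷ _) zero    = p
    Below-lookup (_ ∷ σs) f g (_ ∷ τs) (_ ∷ h) (suc t) = Below-lookup σs f g τs h t

    cells-avoid : ∀ τs → containsParB σs τs ≡ false → Avoids pattern₀ (cells τs)
    cells-avoid τs eq (f , f∈ , ord) = contradiction
      (trans (sym eq) (Occurs⇒containsParB σs τs σs-inj (λ i → proj₁ (pre i))
        ((λ i i' lt → increasing i i' lt (below i i')) , λ t i i' → ordered t i i' (below i i')))) λ ()
      where
      pre : ∀ i → ∃ λ c → c ∈ allFin n × f i ≡ cell τs c
      pre i = ∈-map⁻ (cell τs) (f∈ i)

      p : Fin (suc κ) → Fin n
      p i = proj₁ (pre i)

      below : ∀ i i' → Below i i' pattern₀ (toℕ (p i) ∷ row τs (p i)) (toℕ (p i') ∷ row τs (p i'))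
      below i i' = Below-quotient w _ _
        (subst₂ (Below i i' pattern₀) (proj₂ (proj₂ (pre i))) (proj₂ (proj₂ (pre i'))) (ord i i'))

      increasing : ∀ i i' → toℕ i < toℕ i' → Below i i' pattern₀ (toℕ (p i) ∷ row τs (p i)) (toℕ (p i') ∷ row τs (p i')) →
        toℕ (p i) < toℕ (p i')
      increasing i i' lt (h ∷ _) = h (subst₂ (λ x y → toℕ x < toℕ y)
        (sym (V.lookup∘tabulate id i)) (sym (V.lookup∘tabulate id i')) lt)

      ordered : ∀ t i i' → Below i i' pattern₀ (toℕ (p i) ∷ row τs (p i)) (toℕ (p i') ∷ row τs (p i')) →
        toℕ (V.lookup (V.lookup σs t) i) < toℕ (V.lookup (V.lookup σs t) i') →
        toℕ (V.lookup (V.lookup τs t) (p i)) < toℕ (V.lookup (V.lookup τs t) (p i'))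
      ordered t i i' (_ ∷ h) = Below-lookup σs (λ τ → toℕ (V.lookup τ (p i))) (λ τ → toℕ (V.lookup τ (p i'))) τs h t

    slab : List Point → ℕ → List Point
    slab L h = filter (λ a → head₀ a ≟ h) (deduplicate _≟ᵖ_ L)

    -- Each occupied cell of a slab contains one of the at most w positions of that slab.
    length-slab : ∀ τs L → (∀ {a} → a ∈ L → a ∈ cells τs) → ∀ h → length (slab L h) ≤ w
    length-slab τs L L⊆ h = ≤-trans
      (length-⊆ (Unique.filter⁺ _ (UniqueDec.deduplicate-! _≟ᵖ_ L)) occupied)
      (≤-trans (≤-reflexive (length-map (cell τs) positions))
      (≤-trans (length-injection (λ c → toℕ c % w) (Unique.filter⁺ _ (Unique.allFin⁺ n))
        (λ {c} _ → ∈-upTo⁺ (m%n<n (toℕ c) w)) inj)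
      (≤-reflexive (length-upTo w))))
      where
      positions : List (Fin n)
      positions = filter (λ c → toℕ c / w ≟ h) (allFin n)

      occupied : ∀ {a} → a ∈ slab L h → a ∈ map (cell τs) positions
      occupied a∈ with ∈-filter⁻ (λ a → head₀ a ≟ h) {xs = deduplicate _≟ᵖ_ L} a∈
      ... | a∈' , eq with ∈-map⁻ (cell τs) (L⊆ (∈-deduplicate⁻ _≟ᵖ_ L a∈'))
      ... | c , c∈ , refl = ∈-map⁺ (cell τs) (∈-filter⁺ _ c∈ eq)

      inj : ∀ {c c'} → c ∈ positions → c' ∈ positions → toℕ c % w ≡ toℕ c' % w → c ≡ c'
      inj {c} {c'} c∈ c'∈ eq = toℕ-injective (begin
        toℕ c                             ≡⟨ m≡m%n+[m/n]*n (toℕ c) w ⟩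
        toℕ c % w + toℕ c / w * w         ≡⟨ cong₂ (λ x y → x + y * w) eq (trans (block c∈) (sym (block c'∈))) ⟩
        toℕ c' % w + toℕ c' / w * w       ≡⟨ m≡m%n+[m/n]*n (toℕ c') w ⟨
        toℕ c'                            ∎)
        where
        open ≡-Reasoning
        block : ∀ {c} → c ∈ positions → toℕ c / w ≡ h
        block c∈ = proj₂ (∈-filter⁻ (λ c → toℕ c / w ≟ h) {xs = allFin n} c∈)

    -- The truncation makes the count valid for every list `L`. When `L` consists of cells of a
    -- tuple, each slab has at most `w` of them and nothing is cut.
    options : List Point → Fin n → List Point
    options L c = concatMap (children w d ∘ tail₀) (take w (slab L (toℕ c / w)))

    length-options : ∀ L c → length (options L c) ≤ w * w ^ d
    length-options L c = ≤-trans
      (length-concatMap-≤ _ (w ^ d) (take w (slab L (toℕ c / w))) λ {a} _ → length-children w d (tail₀ a))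
      (*-monoˡ-≤ (w ^ d) (length-take-≤ w _))

    rows : Tuple → Vec Point n
    rows τs = V.tabulate (row τs)

    rows-injective : ∀ τs τs' → rows τs ≡ rows τs' → τs ≡ τs'
    rows-injective τs τs' eq = columns τs τs' λ c →
      trans (sym (V.lookup∘tabulate (row τs) c)) (trans (cong (λ v → V.lookup v c) eq) (V.lookup∘tabulate (row τs') c))
      where
      columns : ∀ {d} (τs τs' : Vec (Vec (Fin n) n) d) →
        (∀ c → V.toList (V.map (λ τ → toℕ (V.lookup τ c)) τs) ≡ V.toList (V.map (λ τ → toℕ (V.lookup τ c)) τs')) → τs ≡ τs'
      columns []       []         h = refl
      columns (τ ∷ τs) (τ' ∷ τs') h = cong₂ _∷_
        (trans (sym (V.tabulate∘lookup τ))
          (trans (V.tabulate-cong (λ c → toℕ-injective (∷-injectiveˡ (h c)))) (V.tabulate∘lookup τ')))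
        (columns τs τs' (λ c → ∷-injectiveʳ (h c)))

    rows∈ : ∀ τs → containsParB σs τs ≡ false → rows τs ∈ concatMap (choices ∘ options) (family s large d j)
    rows∈ τs eq with covered s large d pattern₀ (cong suc (V.length-toList σs)) j (cells τs) (cells⊂ τs) (cells-avoid τs eq)
    ... | L , L∈ , A⊆L , L⊆A = ∈-concatMap (choices ∘ options) L∈ (∈-choices (options L) (row τs) option)
      where
      option : ∀ c → row τs c ∈ options L c
      option c = ∈-concatMap (children w d ∘ tail₀)
        (subst (cell τs c ∈_) (sym (take-all w _ (length-slab τs L L⊆A (toℕ c / w))))
          (∈-filter⁺ _ (∈-deduplicate⁺ _≟ᵖ_ (A⊆L (∈-map⁺ (cell τs) (∈-allFin c)))) refl))
        (subst (λ D → row τs c ∈ children w D (quotient w (row τs c))) (length-row τs c) (∈-children w (row τs c)))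

    S-upper : S n σs ≤ length (family s large d j) * (w * w ^ d) ^ n
    S-upper = ≤-trans
      (length-injection rows (Unique.filter⁺ _ (allVecs-unique d (perms-unique n)))
        (λ {τs} τs∈ → rows∈ τs (not-true (proj₂ (∈-filterᵇ⁻ (λ τs → not (containsParB σs τs)) {xs = allVecs d (perms n)} τs∈))))
        (λ _ _ → rows-injective _ _))
      (length-concatMap-≤ (choices ∘ options) ((w * w ^ d) ^ n) (family s large d j)
        λ {L} _ → length-choices (options L) (w * w ^ d) (length-options L))
      where
      not-true : ∀ {b} → not b ≡ true → b ≡ false
      not-true {false} _ = refl

  -- The lower bound

  length-allFin : ∀ n → length (allFin n) ≡ n
  length-allFin n = length-tabulate id

  -- A missed value together with the image would give `n + 1` distinct elements of `Fin n`.
  surjective : ∀ {n} (f : Fin n → Fin n) → (∀ {x y} → f x ≡ f y → x ≡ y) → ∀ y → ∃ λ x → f x ≡ y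
  surjective {n} f inj y with any? (λ x → f x ≟ᶠ y)
  ... | yes found = found
  ... | no  none  = contradiction
    (subst₂ _≤_ (cong suc (trans (length-map f (allFin n)) (length-allFin n))) (length-allFin n)
      (length-⊆ (All.tabulate (λ {z} z∈ y≡z → let x , _ , z≡ = ∈-map⁻ f z∈ in none (x , sym (trans y≡z z≡)))
                 ∷ Unique.map⁺ inj (Unique.allFin⁺ n)) (λ {x} _ → ∈-allFin x)))
    1+n≰n

  module _ {n : ℕ} where

    count : {P : Fin n → Set} → Decidable P → ℕ
    count P? = length (filter P? (allFin n))

    count-≤ : {P Q : Fin n → Set} (P? : Decidable P) (Q? : Decidable Q) → (∀ x → P x → Q x) → count P? ≤ count Q?
    count-≤ P? Q? h = length-⊆ (Unique.filter⁺ P? (Unique.allFin⁺ n)) λ {x} x∈ →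
      ∈-filter⁺ Q? (∈-allFin x) (h x (proj₂ (∈-filter⁻ P? {xs = allFin n} x∈)))

    count-< : {P Q : Fin n → Set} (P? : Decidable P) (Q? : Decidable Q) → (∀ x → P x → Q x) →
      ∀ z → Q z → ¬ P z → count P? < count Q?
    count-< {P} {Q} P? Q? h z qz ¬pz = length-⊆
      (All.tabulate (λ x∈ z≡x → ¬pz (subst P (sym z≡x) (proj₂ (∈-filter⁻ P? {xs = allFin n} x∈))))
       ∷ Unique.filter⁺ P? (Unique.allFin⁺ n))
      λ where (here refl) → ∈-filter⁺ Q? (∈-allFin z) qz
              (there x∈)  → ∈-filter⁺ Q? (∈-allFin _) (h _ (proj₂ (∈-filter⁻ P? {xs = allFin n} x∈)))

    count-≤n : {P : Fin n → Set} (P? : Decidable P) → count P? ≤ n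
    count-≤n P? = ≤-trans (length-filter P? (allFin n)) (≤-reflexive (length-allFin n))

    count-<n : {P : Fin n → Set} (P? : Decidable P) → ∀ z → ¬ P z → count P? < n
    count-<n P? z ¬pz = <-≤-trans (count-< P? (λ _ → yes tt) (λ _ _ → tt) z tt ¬pz) (count-≤n _)

  values : (ℕ → ℕ) → ℕ → List ℕ
  values F zero    = []
  values F (suc M) = F M ∷ values F M

  values-injective : ∀ F G M → values F M ≡ values G M → ∀ {t} → t < M → F t ≡ G t
  values-injective F G (suc M) eq {t} (s≤s t≤M) with m≤n⇒m<n∨m≡n t≤M
  ... | inj₁ t<M  = values-injective F G M (∷-injectiveʳ eq) t<M
  ... | inj₂ refl = ∷-injectiveˡ eq

  descending : ℕ → ℕ → List (List ℕ)
  descending zero    n       = [ [] ]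
  descending (suc M) zero    = map (0 ∷_) (descending M 0)
  descending (suc M) (suc n) = map (suc n ∷_) (descending M (suc n)) ++ descending (suc M) n

  -- The lists are lattice paths: each step either records the current height or lowers it by one,
  -- so there are at most `M + n` binary choices.
  length-descending : ∀ M n → length (descending M n) ≤ 2 ^ (M + n)
  length-descending zero    n       = m^n>0 2 n
  length-descending (suc M) zero    = ≤-trans (≤-reflexive (length-map _ (descending M 0)))
    (≤-trans (length-descending M 0) (^-monoʳ-≤ 2 (n≤1+n (M + 0))))
  length-descending (suc M) (suc n) = begin
    length (map (suc n ∷_) (descending M (suc n)) ++ descending (suc M) n)
      ≡⟨ length-++ (map (suc n ∷_) (descending M (suc n))) ⟩
    length (map (suc n ∷_) (descending M (suc n))) + length (descending (suc M) n)
      ≡⟨ cong (_+ length (descending (suc M) n)) (length-map _ (descending M (suc n))) ⟩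
    length (descending M (suc n)) + length (descending (suc M) n)
      ≤⟨ +-mono-≤ (length-descending M (suc n)) (length-descending (suc M) n) ⟩
    2 ^ (M + suc n) + 2 ^ (suc M + n)
      ≡⟨ cong (2 ^ (M + suc n) +_) (trans (cong (2 ^_) (sym (+-suc M n))) (sym (+-identityʳ _))) ⟩
    2 ^ (suc M + suc n) ∎
    where open ≤-Reasoning

  values∈descending : ∀ F → (∀ {a b} → a ≤ b → F a ≤ F b) → ∀ M n → (∀ t → t < M → F t ≤ n) → values F M ∈ descending M n
  values∈descending F mono zero    n       h = here refl
  values∈descending F mono (suc M) zero    h =
    subst (λ v → (v ∷ values F M) ∈ map (0 ∷_) (descending M 0)) (sym (n≤0⇒n≡0 (h M ≤-refl)))
      (∈-map⁺ (0 ∷_) (values∈descending F mono M 0 λ t t< → h t (m<n⇒m<1+n t<)))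
  values∈descending F mono (suc M) (suc n) h with m≤n⇒m<n∨m≡n (h M ≤-refl)
  ... | inj₁ (s≤s FM≤n) = ∈-++⁺ʳ (map (suc n ∷_) (descending M (suc n)))
    (values∈descending F mono (suc M) n λ t t< → ≤-trans (mono (≤-pred t<)) FM≤n)
  ... | inj₂ eq = ∈-++⁺ˡ (subst (λ v → (v ∷ values F M) ∈ map (suc n ∷_) (descending M (suc n))) (sym eq)
    (∈-map⁺ (suc n ∷_) (values∈descending F mono M (suc n) λ t t< → h t (m<n⇒m<1+n t<))))

  lexicographic : ∀ {a a' b b' k} → b < k → a < a' → a * k + b < a' * k + b'
  lexicographic {a} {a'} {b} {b'} {k} b<k a<a' = begin-strict
    a * k + b    <⟨ +-monoʳ-< (a * k) b<k ⟩
    a * k + k    ≡⟨ +-comm (a * k) k ⟩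
    suc a * k    ≤⟨ *-monoˡ-≤ k a<a' ⟩
    a' * k       ≤⟨ m≤m+n (a' * k) b' ⟩
    a' * k + b'  ∎
    where open ≤-Reasoning

  lexicographic-≡ : ∀ {a a' b b' k} → b < k → b' < k → a * k + b ≡ a' * k + b' → a ≡ a' × b ≡ b'
  lexicographic-≡ {a} {a'} {b} {b'} {k} b<k b'<k eq with <-cmp a a'
  ... | tri< lt _ _   = contradiction eq (<⇒≢ (lexicographic b<k lt))
  ... | tri> _ _ gt   = contradiction (sym eq) (<⇒≢ (lexicographic b'<k gt))
  ... | tri≈ _ refl _ = refl , +-cancelˡ-≡ (a * k) b b' eq

  -- Breaking ties between equal levels by seeds

  module Rank {n q : ℕ} (ℓ : Fin n → ℕ) where

    -- A two-digit number to base `q` with the level as leading digit: seeds decide only between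
    -- equal levels.
    key : Vec (Fin q) n → Fin n → ℕ
    key u x = ℓ x * q + toℕ (V.lookup u x)

    -- The index as last digit makes all sort keys distinct, so that the ranks form a permutation.
    sortKey : Vec (Fin q) n → Fin n → ℕ
    sortKey u x = key u x * n + toℕ x

    rank : Vec (Fin q) n → Fin n → Fin n
    rank u x = fromℕ< (count-<n (λ y → sortKey u y <? sortKey u x) x (<-irrefl refl))

    toℕ-rank : ∀ u x → toℕ (rank u x) ≡ count (λ y → sortKey u y <? sortKey u x)
    toℕ-rank u x = toℕ-fromℕ< _

    rank-< : ∀ u {x y} → sortKey u x < sortKey u y → toℕ (rank u x) < toℕ (rank u y)
    rank-< u {x} {y} lt = subst₂ _<_ (sym (toℕ-rank u x)) (sym (toℕ-rank u y))
      (count-< (λ z → sortKey u z <? sortKey u x) (λ z → sortKey u z <? sortKey u y) (λ z h → <-trans h lt) x lt (<-irrefl refl))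

    rank-injective : ∀ u {x y} → rank u x ≡ rank u y → x ≡ y
    rank-injective u {x} {y} eq with <-cmp (sortKey u x) (sortKey u y)
    ... | tri< lt _ _ = contradiction (cong toℕ eq) (<⇒≢ (rank-< u lt))
    ... | tri> _ _ gt = contradiction (cong toℕ (sym eq)) (<⇒≢ (rank-< u gt))
    ... | tri≈ _ e _  = toℕ-injective (proj₂ (lexicographic-≡ {key u x} {key u y} (toℕ<n x) (toℕ<n y) e))

    rank-≤⇒level-≤ : ∀ u {x y} → toℕ (rank u x) ≤ toℕ (rank u y) → ℓ x ≤ ℓ y
    rank-≤⇒level-≤ u {x} {y} le = ≮⇒≥ λ lt → <⇒≱
      (rank-< u (lexicographic (toℕ<n y) (lexicographic (toℕ<n (V.lookup u y)) lt))) le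

    smaller : Vec (Fin q) n → ℕ → ℕ
    smaller u t = count (λ y → key u y <? t)

    smaller-mono : ∀ u {a b} → a ≤ b → smaller u a ≤ smaller u b
    smaller-mono u {a} {b} a≤b = count-≤ (λ y → key u y <? a) (λ y → key u y <? b) λ y h → <-≤-trans h a≤b

    smaller-≤-rank : ∀ u x {t} → t ≤ key u x → smaller u t ≤ toℕ (rank u x)
    smaller-≤-rank u x {t} t≤ = subst (smaller u t ≤_) (sym (toℕ-rank u x))
      (count-≤ (λ y → key u y <? t) (λ y → sortKey u y <? sortKey u x) λ y h → lexicographic (toℕ<n y) (<-≤-trans h t≤))

    rank-<-smaller : ∀ u x {t} → key u x < t → toℕ (rank u x) < smaller u t
    rank-<-smaller u x {t} lt = subst (_< smaller u t) (sym (toℕ-rank u x))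
      (count-< (λ y → sortKey u y <? sortKey u x) (λ y → key u y <? t)
        (λ y h → ≤-<-trans (≮⇒≥ λ gt → <-asym h (lexicographic (toℕ<n x) gt)) lt) x lt (<-irrefl refl))

    -- The multiset of keys, encoded by its counting function. That function is monotone with values
    -- at most `n`, so `descending` bounds the number of profiles.
    profile : ℕ → Vec (Fin q) n → List ℕ
    profile M u = values (smaller u) M

    -- The key of the element of rank r is the largest t with smaller t ≤ r.
    profile-key : ∀ {M} u u' {x y} → profile M u ≡ profile M u' → rank u x ≡ rank u' y →
      key u x < M → key u' y < M → key u x ≡ key u' y
    profile-key {M} u u' {x} {y} pf rk x<M y<M with <-cmp (key u x) (key u' y)
    ... | tri≈ _ eq _ = eq
    ... | tri< lt _ _ = contradiction
      (subst₂ _<_ (cong toℕ rk) (values-injective (smaller u) (smaller u') M pf y<M) (rank-<-smaller u x lt))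
      (≤⇒≯ (smaller-≤-rank u' y ≤-refl))
    ... | tri> _ _ gt = contradiction
      (subst₂ _<_ (cong toℕ (sym rk)) (sym (values-injective (smaller u) (smaller u') M pf x<M)) (rank-<-smaller u' y gt))
      (≤⇒≯ (smaller-≤-rank u x ≤-refl))

    key-< : ∀ u x {b} → ℓ x < b → key u x < b * q
    key-< u x {b} lt = subst (key u x <_) (+-identityʳ (b * q)) (lexicographic {b' = 0} (toℕ<n (V.lookup u x)) lt)

  -- Weak in both directions, because comparing ranks compares levels only up to ties.
  Directed : Bool → ℕ → ℕ → Set
  Directed true  a b = a ≤ b
  Directed false a b = b ≤ a

  directed : ∀ b {x y} → (x <ᵇ y) ≡ b → Directed b x y
  directed true  eq = <⇒≤ (<ᵇ-true⁻¹ eq)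
  directed false eq = ≮⇒≥ λ lt → contradiction (trans (sym eq) (<ᵇ-true lt)) λ ()

  Directed-refl : ∀ b {x y} → x ≡ y → Directed b x y
  Directed-refl true  refl = ≤-refl
  Directed-refl false refl = ≤-refl

  -- Avoiding tuples built from an antichain of labels

  module LowerCount {m n d : ℕ} (σs : Vec (Vec (Fin m) m) d) (j₀ j₁ : Fin m) (j₀<j₁ : toℕ j₀ < toℕ j₁)
    (ℓ : Fin (suc d) → Fin n → ℕ) (b q : ℕ) (ℓ< : ∀ i x → ℓ i x < b)
    (antichain : ∀ x y → ℓ zero x ≤ ℓ zero y →
      (∀ i → Directed (V.lookup (V.lookup σs i) j₀ <F V.lookup (V.lookup σs i) j₁) (ℓ (suc i) x) (ℓ (suc i) y)) → x ≡ y) where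

    -- On each axis the seeds break the ties between labels of equal level. The resulting tuple
    -- determines them up to the list of all keys in increasing order, which leaves at most
    -- 2 ^ (b * q + n) possibilities per axis.
    Seeds : Set
    Seeds = Vec (Vec (Fin q) n) (suc d)

    module _ (us : Seeds) where

      position : Fin (suc d) → Fin n → Fin n
      position i = Rank.rank (ℓ i) (V.lookup us i)

      label : Fin n → Fin n
      label c = proj₁ (surjective (position zero) (Rank.rank-injective (ℓ zero) (V.lookup us zero)) c)

      position-label : ∀ c → position zero (label c) ≡ c
      position-label c = proj₂ (surjective (position zero) (Rank.rank-injective (ℓ zero) (V.lookup us zero)) c)

      label-position : ∀ x → label (position zero x) ≡ x
      label-position x = Rank.rank-injective (ℓ zero) (V.lookup us zero) (position-label (position zero x))

      -- The ranks on axis `zero` serve as positions, those on axis `suc i` as the values of the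
      -- permutation with index `i`.
      tuple : Vec (Vec (Fin n) n) d
      tuple = V.tabulate λ i → V.tabulate λ c → position (suc i) (label c)

      lookup-tuple : ∀ i c → V.lookup (V.lookup tuple i) c ≡ position (suc i) (label c)
      lookup-tuple i c = trans
        (cong (λ v → V.lookup v c) (V.lookup∘tabulate (λ i → V.tabulate λ c → position (suc i) (label c)) i))
        (V.lookup∘tabulate _ c)

      label-injective : ∀ {c c'} → label c ≡ label c' → c ≡ c'
      label-injective {c} {c'} eq = trans (sym (position-label c)) (trans (cong (position zero) eq) (position-label c'))

      tuple-injective : ∀ i → Injective (V.lookup tuple i)
      tuple-injective i c c' eq = label-injective (Rank.rank-injective (ℓ (suc i)) (V.lookup us (suc i))
        (trans (sym (lookup-tuple i c)) (trans eq (lookup-tuple i c'))))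

      -- An occurrence would put the labels at `c j₀` and `c j₁` into the weak relation that
      -- `antichain` collapses to equality, although their positions differ.
      tuple-avoids : containsParB σs tuple ≡ false
      tuple-avoids = containsParB-false σs tuple λ c inc iso →
        let lt = inc j₀ j₁ j₀<j₁ in
        <⇒≢ lt (cong toℕ (label-injective (antichain (label (c j₀)) (label (c j₁))
          (Rank.rank-≤⇒level-≤ (ℓ zero) (V.lookup us zero)
            (subst₂ (λ x y → toℕ x ≤ toℕ y) (sym (position-label (c j₀))) (sym (position-label (c j₁))) (<⇒≤ lt)))
          λ i → level i (V.lookup (V.lookup σs i) j₀ <F V.lookup (V.lookup σs i) j₁)
            (subst₂ (λ x y → (x <F y) ≡ _) (lookup-tuple i (c j₀)) (lookup-tuple i (c j₁)) (iso i j₀ j₁)))))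
        where
        level : ∀ i e {x y} → (position (suc i) x <F position (suc i) y) ≡ e → Directed e (ℓ (suc i) x) (ℓ (suc i) y)
        level i true  eq = Rank.rank-≤⇒level-≤ (ℓ (suc i)) (V.lookup us (suc i)) (directed true eq)
        level i false eq = Rank.rank-≤⇒level-≤ (ℓ (suc i)) (V.lookup us (suc i)) (directed false eq)

      tuple∈ : tuple ∈ filterᵇ (λ τs → not (containsParB σs τs)) (allVecs d (perms n))
      tuple∈ = ∈-filterᵇ⁺ (λ τs → not (containsParB σs τs)) (∈-allVecs tuple λ i → ∈-perms (V.lookup tuple i) (tuple-injective i))
        (cong not tuple-avoids)

      profiles : Vec (List ℕ) (suc d)
      profiles = V.tabulate λ i → Rank.profile (ℓ i) (b * q) (V.lookup us i)

      profiles∈ : profiles ∈ allVecs (suc d) (descending (b * q) n)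
      profiles∈ = ∈-allVecs profiles λ i →
        subst (_∈ descending (b * q) n) (sym (V.lookup∘tabulate (λ i → Rank.profile (ℓ i) (b * q) (V.lookup us i)) i))
          (values∈descending _ (Rank.smaller-mono (ℓ i) (V.lookup us i)) (b * q) n λ t _ → count-≤n _)

    -- At each position, rank and profile determine the key, hence level and seed, on every axis.
    -- Equal levels on all axes identify the labels, again by `antichain`; after that the seeds
    -- agree label by label.
    encode-injective : ∀ us us' → tuple us ≡ tuple us' → profiles us ≡ profiles us' → us ≡ us'
    encode-injective us us' teq peq = lookup-ext λ i → lookup-ext λ x →
      subst (λ z → V.lookup (V.lookup us i) z ≡ V.lookup (V.lookup us' i) z) (label-position us x) (at-label i (position us zero x))
      where
      lookup-ext : ∀ {X k} {v w : Vec X k} → (∀ i → V.lookup v i ≡ V.lookup w i) → v ≡ w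
      lookup-ext {v = v} {w} h = trans (sym (V.tabulate∘lookup v)) (trans (V.tabulate-cong h) (V.tabulate∘lookup w))

      profile≡ : ∀ i → Rank.profile (ℓ i) (b * q) (V.lookup us i) ≡ Rank.profile (ℓ i) (b * q) (V.lookup us' i)
      profile≡ i = trans (sym (V.lookup∘tabulate (λ i → Rank.profile (ℓ i) (b * q) (V.lookup us i)) i))
        (trans (cong (λ v → V.lookup v i) peq) (V.lookup∘tabulate (λ i → Rank.profile (ℓ i) (b * q) (V.lookup us' i)) i))

      position≡ : ∀ i c → position us i (label us c) ≡ position us' i (label us' c)
      position≡ zero    c = trans (position-label us c) (sym (position-label us' c))
      position≡ (suc i) c = trans (sym (lookup-tuple us i c))
        (trans (cong (λ v → V.lookup (V.lookup v i) c) teq) (lookup-tuple us' i c))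

      key≡ : ∀ i c → ℓ i (label us c) ≡ ℓ i (label us' c) ×
        toℕ (V.lookup (V.lookup us i) (label us c)) ≡ toℕ (V.lookup (V.lookup us' i) (label us' c))
      key≡ i c = lexicographic-≡ (toℕ<n (V.lookup (V.lookup us i) _)) (toℕ<n (V.lookup (V.lookup us' i) _))
        (Rank.profile-key (ℓ i) (V.lookup us i) (V.lookup us' i) (profile≡ i) (position≡ i c)
          (Rank.key-< (ℓ i) (V.lookup us i) _ (ℓ< i _)) (Rank.key-< (ℓ i) (V.lookup us' i) _ (ℓ< i _)))

      label≡ : ∀ c → label us c ≡ label us' c
      label≡ c = antichain _ _ (≤-reflexive (proj₁ (key≡ zero c))) λ i → Directed-refl _ (proj₁ (key≡ (suc i) c))

      at-label : ∀ i c → V.lookup (V.lookup us i) (label us c) ≡ V.lookup (V.lookup us' i) (label us c)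
      at-label i c = trans (toℕ-injective (proj₂ (key≡ i c))) (cong (V.lookup (V.lookup us' i)) (sym (label≡ c)))

    -- Seeds inject into pairs of an avoiding tuple and `suc d` profiles.
    S-lower : (q ^ n) ^ suc d ≤ S n σs * (2 ^ (b * q + n)) ^ suc d
    S-lower = begin
      (q ^ n) ^ suc d
        ≡⟨ cong (λ k → (k ^ n) ^ suc d) (length-allFin q) ⟨
      (length (allFin q) ^ n) ^ suc d
        ≡⟨ cong (_^ suc d) (length-allVecs n (allFin q)) ⟨
      length (allVecs n (allFin q)) ^ suc d
        ≡⟨ length-allVecs (suc d) (allVecs n (allFin q)) ⟨
      length (allVecs (suc d) (allVecs n (allFin q)))
        ≤⟨ length-injection (λ us → tuple us , profiles us) (allVecs-unique (suc d) (allVecs-unique n (Unique.allFin⁺ q)))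
             (λ {us} _ → ∈-concatMap _ (tuple∈ us) (∈-map⁺ (tuple us ,_) (profiles∈ us)))
             (λ {us} {us'} _ _ eq → encode-injective us us' (proj₁ (,-injective eq)) (proj₂ (,-injective eq))) ⟩
      length (concatMap (λ τs → map (τs ,_) codes) avoiders)
        ≡⟨ length-concatMap-map _,_ avoiders codes ⟩
      S n σs * length codes
        ≡⟨ cong (S n σs *_) (length-allVecs (suc d) (descending (b * q) n)) ⟩
      S n σs * length (descending (b * q) n) ^ suc d
        ≤⟨ *-monoʳ-≤ (S n σs) (^-monoˡ-≤ (suc d) (length-descending (b * q) n)) ⟩
      S n σs * (2 ^ (b * q + n)) ^ suc d ∎
      where
      open ≤-Reasoning
      codes : List (Vec (List ℕ) (suc d))
      codes = allVecs (suc d) (descending (b * q) n)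
      avoiders : List (Vec (Vec (Fin n) n) d)
      avoiders = filterᵇ (λ τs → not (containsParB σs τs)) (allVecs d (perms n))

  -- Digit vectors as an antichain of labels

  module Digits (N : ℕ) .{{_ : NonZero N}} where

    digits : ∀ d → ℕ → Vec ℕ d
    digits zero    x = []
    digits (suc d) x = x % N ∷ digits d (x / N)

    digits-injective : ∀ d {x y} → x < N ^ d → y < N ^ d → digits d x ≡ digits d y → x ≡ y
    digits-injective zero    (s≤s z≤n) (s≤s z≤n) _  = refl
    digits-injective (suc d) {x} {y} x< y< eq = begin
      x                      ≡⟨ m≡m%n+[m/n]*n x N ⟩
      x % N + x / N * N      ≡⟨ cong₂ (λ r k → r + k * N) (V.∷-injectiveˡ eq)
                                  (digits-injective d (smaller x<) (smaller y<) (V.∷-injectiveʳ eq)) ⟩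
      y % N + y / N * N      ≡⟨ m≡m%n+[m/n]*n y N ⟨
      y                      ∎
      where
      open ≡-Reasoning
      smaller : ∀ {z} → z < N ^ suc d → z / N < N ^ d
      smaller {z} z< = m<n*o⇒m/o<n (subst (z <_) (*-comm N (N ^ d)) z<)

    sum-digits : ∀ d x → V.sum (digits d x) ≤ d * N
    sum-digits zero    x = z≤n
    sum-digits (suc d) x = +-mono-≤ (m%n≤n x N) (sum-digits d (x / N))

    -- The generous bound `d * N` gives digits and digit sums the same range of levels, so that one
    -- `b` serves all axes.
    digit-≤ : ∀ d x i → V.lookup (digits d x) i ≤ d * N
    digit-≤ (suc d) x zero    = ≤-trans (m%n≤n x N) (m≤m+n N (d * N))
    digit-≤ (suc d) x (suc i) = ≤-trans (digit-≤ d (x / N) i) (m≤n+m (d * N) N)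

  sum-mono : ∀ {d} (v w : Vec ℕ d) → (∀ i → V.lookup v i ≤ V.lookup w i) → V.sum v ≤ V.sum w
  sum-mono []      []      h = z≤n
  sum-mono (x ∷ v) (y ∷ w) h = +-mono-≤ (h zero) (sum-mono v w (h ∘ suc))

  -- One strictly larger entry, with no entry smaller, would make the sum strictly larger.
  ≤-antisym-sum : ∀ {d} (v w : Vec ℕ d) → (∀ i → V.lookup v i ≤ V.lookup w i) → V.sum w ≤ V.sum v → v ≡ w
  ≤-antisym-sum []      []      h le = refl
  ≤-antisym-sum (x ∷ v) (y ∷ w) h le with m≤n⇒m<n∨m≡n (h zero)
  ... | inj₁ x<y  = contradiction le (<⇒≱ (+-mono-<-≤ x<y (sum-mono v w (h ∘ suc))))
  ... | inj₂ refl = cong (x ∷_) (≤-antisym-sum v w (h ∘ suc) (+-cancelˡ-≤ x _ _ le))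

  ∸-cancelˡ-≤ : ∀ m {n o} → n ≤ o → o ∸ m ≤ o ∸ n → n ≤ m
  ∸-cancelˡ-≤ m n≤o h = ≮⇒≥ λ m<n → <⇒≱ (∸-monoʳ-< m<n n≤o) h

  -- Reversing the axes on which the two chosen pattern entries fall reduces every pattern to the
  -- increasing one.
  orient : Bool → ℕ → ℕ → ℕ
  orient true  L v = v
  orient false L v = L ∸ v

  orient-≤ : ∀ b {L v} → v ≤ L → orient b L v ≤ L
  orient-≤ true      v≤ = v≤
  orient-≤ false {L} {v} _ = m∸n≤m L v

  Directed-orient : ∀ b {L v w} → v ≤ L → w ≤ L → Directed b (orient b L v) (orient b L w) → v ≤ w
  Directed-orient true  _   _   h = h
  Directed-orient false {w = w} v≤L w≤L h = ∸-cancelˡ-≤ w v≤L h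

  -- Comparable labels with the same digit sum coincide, so reversing the order of the
  -- digit sum on one axis turns the grid of all digit vectors into an antichain.
  module Levels (N : ℕ) .{{_ : NonZero N}} {n d : ℕ} (n≤ : n ≤ N ^ d) (ε : Fin d → Bool) where

    open Digits N

    level : Fin (suc d) → Fin n → ℕ
    level zero    x = d * N ∸ V.sum (digits d (toℕ x))
    level (suc i) x = orient (ε i) (d * N) (V.lookup (digits d (toℕ x)) i)

    level-< : ∀ i x → level i x < suc (d * N)
    level-< zero    x = s≤s (m∸n≤m (d * N) (V.sum (digits d (toℕ x))))
    level-< (suc i) x = s≤s (orient-≤ (ε i) (digit-≤ d (toℕ x) i))

    level-antichain : ∀ x y → level zero x ≤ level zero y →
      (∀ i → Directed (ε i) (level (suc i) x) (level (suc i) y)) → x ≡ y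
    level-antichain x y h₀ h = toℕ-injective (digits-injective d (<-≤-trans (toℕ<n x) n≤) (<-≤-trans (toℕ<n y) n≤)
      (≤-antisym-sum _ _ (λ i → Directed-orient (ε i) (digit-≤ d (toℕ x) i) (digit-≤ d (toℕ y) i) (h i))
        (∸-cancelˡ-≤ (V.sum (digits d (toℕ x))) (sum-digits d (toℕ y)) h₀)))

  -- Asymptotics

  -- Induction on `n`: `j` moves up exactly when `n` reaches `(s ^ suc j) ^ d`, and `2 ≤ s ^ d`
  -- keeps the next power strictly ahead.
  scale : ∀ s d → 2 ≤ s ^ d → ∀ n → 1 ≤ n → ∃ λ j → (s ^ j) ^ d ≤ n × n < (s ^ suc j) ^ d
  scale s d 2≤ (suc zero)    _ = 0 , ≤-reflexive (^-zeroˡ d) , subst (λ x → 1 < x ^ d) (sym (*-identityʳ s)) 2≤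
  scale s d 2≤ (suc (suc n)) _ with scale s d 2≤ (suc n) (s≤s z≤n)
  ... | j , lo , hi with m≤n⇒m<n∨m≡n hi
  ... | inj₁ lt = j , ≤-trans lo (n≤1+n _) , lt
  ... | inj₂ eq = suc j , ≤-reflexive (sym eq) , <-≤-trans (s≤s (≤-reflexive eq)) (begin
    1 + (s ^ suc j) ^ d                  ≤⟨ +-monoˡ-≤ _ (≤-trans (s≤s z≤n) (≤-reflexive eq)) ⟩
    (s ^ suc j) ^ d + (s ^ suc j) ^ d    ≡⟨ cong ((s ^ suc j) ^ d +_) (+-identityʳ _) ⟨
    2 * (s ^ suc j) ^ d                  ≤⟨ *-monoˡ-≤ _ 2≤ ⟩
    s ^ d * (s ^ suc j) ^ d              ≡⟨ ^-distribʳ-* d s (s ^ suc j) ⟨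
    (s ^ suc (suc j)) ^ d                ∎)
    where open ≤-Reasoning

  ^-swap : ∀ a m n → (a ^ m) ^ n ≡ (a ^ n) ^ m
  ^-swap a m n = trans (^-*-assoc a m n) (trans (cong (a ^_) (*-comm m n)) (sym (^-*-assoc a n m)))

  n≤n^ : ∀ x .{{_ : NonZero x}} e → x ≤ x ^ suc e
  n≤n^ x e = m≤m*n x (x ^ e) {{m^n≢0 x e}}

  ≤-quotient : ∀ n b .{{_ : NonZero b}} → n ≤ b * suc (n / b)
  ≤-quotient n b = begin
    n                        ≡⟨ m≡m%n+[m/n]*n n b ⟩
    n % b + n / b * b        ≤⟨ +-monoˡ-≤ _ (m%n≤n n b) ⟩
    suc (n / b) * b          ≡⟨ *-comm (suc (n / b)) b ⟩
    b * suc (n / b)          ∎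
    where open ≤-Reasoning

  quotient-≤ : ∀ n b .{{_ : NonZero b}} → b * suc (n / b) ≤ b + n
  quotient-≤ n b = ≤-trans (≤-reflexive (trans (*-suc b (n / b)) (cong (b +_) (*-comm b (n / b))))) (+-monoʳ-≤ b (m/n*n≤m n b))

  -- The cell side `w` has order n^(1-1/d). Without roots: `n < (s * N) ^ d` and `N * w ≤ n + n`
  -- give `n * w ^ d ≤ (s * 2 * n) ^ d`, and one factor `n` cancels. The exponent then comes from
  -- (d-1)(d+1) = d²-1.
  upper-arithmetic : ∀ e s B n N T .{{_ : NonZero n}} .{{_ : NonZero N}} → let d = suc e ; w = suc (n / N) in
    N ^ d ≤ n → n < (s * N) ^ d → T ≤ 2 ^ (B * n) * (w * w ^ d) ^ n →
    T ^ d ≤ (2 ^ B * (s * 2) ^ suc d) ^ (n * d) * n ^ (n * (d * d ∸ 1))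
  upper-arithmetic e s B n N T lo hi T≤ = begin
    T ^ d
      ≤⟨ ^-monoˡ-≤ d T≤ ⟩
    (2 ^ (B * n) * (w ^ suc d) ^ n) ^ d
      ≡⟨ ^-distribʳ-* d (2 ^ (B * n)) ((w ^ suc d) ^ n) ⟩
    (2 ^ (B * n)) ^ d * ((w ^ suc d) ^ n) ^ d
      ≡⟨ cong₂ _*_ (trans (cong (_^ d) (sym (^-*-assoc 2 B n))) (^-*-assoc (2 ^ B) n d)) regroup ⟩
    (2 ^ B) ^ (n * d) * ((w ^ d) ^ suc d) ^ n
      ≤⟨ *-monoʳ-≤ ((2 ^ B) ^ (n * d)) (^-monoˡ-≤ n (^-monoˡ-≤ (suc d) width)) ⟩
    (2 ^ B) ^ (n * d) * (((s * 2) ^ d * n ^ e) ^ suc d) ^ n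
      ≡⟨ cong ((2 ^ B) ^ (n * d) *_) split ⟩
    (2 ^ B) ^ (n * d) * (((s * 2) ^ suc d) ^ (n * d) * n ^ (n * (d * d ∸ 1)))
      ≡⟨ *-assoc ((2 ^ B) ^ (n * d)) _ _ ⟨
    (2 ^ B) ^ (n * d) * ((s * 2) ^ suc d) ^ (n * d) * n ^ (n * (d * d ∸ 1))
      ≡⟨ cong (_* n ^ (n * (d * d ∸ 1))) (^-distribʳ-* (n * d) (2 ^ B) ((s * 2) ^ suc d)) ⟨
    (2 ^ B * (s * 2) ^ suc d) ^ (n * d) * n ^ (n * (d * d ∸ 1)) ∎
    where
    open ≤-Reasoning
    d w : ℕ
    d = suc e
    w = suc (n / N)

    width : w ^ d ≤ (s * 2) ^ d * n ^ e
    width = *-cancelˡ-≤ n (begin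
      n * w ^ d                    ≤⟨ *-monoˡ-≤ (w ^ d) (<⇒≤ hi) ⟩
      (s * N) ^ d * w ^ d          ≡⟨ ^-distribʳ-* d (s * N) w ⟨
      (s * N * w) ^ d              ≡⟨ cong (_^ d) (*-assoc s N w) ⟩
      (s * (N * w)) ^ d            ≤⟨ ^-monoˡ-≤ d (*-monoʳ-≤ s (≤-trans (quotient-≤ n N) (+-monoˡ-≤ n (≤-trans (n≤n^ N e) lo)))) ⟩
      (s * (n + n)) ^ d            ≡⟨ cong (_^ d) (arith s n) ⟩
      (s * 2 * n) ^ d              ≡⟨ ^-distribʳ-* d (s * 2) n ⟩
      (s * 2) ^ d * (n * n ^ e)    ≡⟨ arith' ((s * 2) ^ d) n (n ^ e) ⟩
      n * ((s * 2) ^ d * n ^ e)    ∎)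
      where
      arith : ∀ s n → s * (n + n) ≡ s * 2 * n
      arith = solve-∀
      arith' : ∀ x n y → x * (n * y) ≡ n * (x * y)
      arith' = solve-∀

    regroup : ((w ^ suc d) ^ n) ^ d ≡ ((w ^ d) ^ suc d) ^ n
    regroup = trans (^-swap (w ^ suc d) n d) (cong (_^ n) (^-swap w (suc d) d))

    exponent : ∀ e n → e * suc (suc e) * n ≡ n * (e + e * suc e)
    exponent = solve-∀

    split : (((s * 2) ^ d * n ^ e) ^ suc d) ^ n ≡ ((s * 2) ^ suc d) ^ (n * d) * n ^ (n * (d * d ∸ 1))
    split = begin-equality
      (((s * 2) ^ d * n ^ e) ^ suc d) ^ n
        ≡⟨ cong (_^ n) (^-distribʳ-* (suc d) ((s * 2) ^ d) (n ^ e)) ⟩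
      (((s * 2) ^ d) ^ suc d * (n ^ e) ^ suc d) ^ n
        ≡⟨ ^-distribʳ-* n (((s * 2) ^ d) ^ suc d) ((n ^ e) ^ suc d) ⟩
      (((s * 2) ^ d) ^ suc d) ^ n * ((n ^ e) ^ suc d) ^ n
        ≡⟨ cong₂ _*_
             (trans (cong (_^ n) (^-swap (s * 2) d (suc d)))
               (trans (^-swap ((s * 2) ^ suc d) d n) (^-*-assoc ((s * 2) ^ suc d) n d)))
             (trans (cong (_^ n) (^-*-assoc n e (suc d)))
               (trans (^-*-assoc n (e * suc d) n) (cong (n ^_) (exponent e n)))) ⟩
      ((s * 2) ^ suc d) ^ (n * d) * n ^ (n * (d * d ∸ 1)) ∎

  -- With `E = n * suc d`, the inequality `n ≤ b * q` brings in `n ^ (E * d)`, and replacing `b ^ d`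
  -- by `a ^ d * n` costs `n ^ E`. Cancelling leaves the exponent E(d-1) = n(d²-1).
  lower-arithmetic : ∀ e n N T .{{_ : NonZero n}} .{{_ : NonZero N}} →
    let d = suc e ; a = suc d * 2 ; b = suc (d * (2 * N)) ; q = suc (n / b) in
    N ^ d ≤ n → (q ^ n) ^ suc d ≤ T * (2 ^ (b * q + n)) ^ suc d →
    n ^ (n * (d * d ∸ 1)) ≤ T ^ d * ((2 ^ (a + 2) * a) ^ suc d) ^ (n * d)
  lower-arithmetic e n N T lo T≥ = *-cancelˡ-≤ (n ^ E) {{m^n≢0 n E}} (begin
    n ^ E * n ^ (n * (d * d ∸ 1))
      ≡⟨ ^-distribˡ-+-* n E _ ⟨
    n ^ (E + n * (d * d ∸ 1))
      ≡⟨ cong (n ^_) (exponent e n) ⟩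
    n ^ (E * d)
      ≡⟨ ^-*-assoc n E d ⟨
    (n ^ E) ^ d
      ≤⟨ ^-monoˡ-≤ d (^-monoˡ-≤ E (≤-quotient n b)) ⟩
    ((b * q) ^ E) ^ d
      ≡⟨ cong (_^ d) (^-distribʳ-* E b q) ⟩
    (b ^ E * q ^ E) ^ d
      ≤⟨ ^-monoˡ-≤ d (*-monoʳ-≤ (b ^ E) seeds) ⟩
    (b ^ E * (T * (2 ^ k) ^ E)) ^ d
      ≡⟨ cong (_^ d) (arith (b ^ E) T ((2 ^ k) ^ E)) ⟩
    (b ^ E * (2 ^ k) ^ E * T) ^ d
      ≡⟨ ^-distribʳ-* d (b ^ E * (2 ^ k) ^ E) T ⟩
    (b ^ E * (2 ^ k) ^ E) ^ d * T ^ d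
      ≡⟨ cong (_* T ^ d) (trans (^-distribʳ-* d (b ^ E) ((2 ^ k) ^ E)) (cong₂ _*_ (^-swap b E d) (^-*-assoc (2 ^ k) E d))) ⟩
    (b ^ d) ^ E * (2 ^ k) ^ (E * d) * T ^ d
      ≤⟨ *-monoˡ-≤ (T ^ d) (*-monoˡ-≤ ((2 ^ k) ^ (E * d)) (^-monoˡ-≤ E levels)) ⟩
    (a ^ d * n) ^ E * (2 ^ k) ^ (E * d) * T ^ d
      ≡⟨ cong (λ z → z * (2 ^ k) ^ (E * d) * T ^ d)
           (trans (^-distribʳ-* E (a ^ d) n) (cong (_* n ^ E) (trans (^-swap a d E) (^-*-assoc a E d)))) ⟩
    a ^ (E * d) * n ^ E * (2 ^ k) ^ (E * d) * T ^ d
      ≡⟨ arith' (a ^ (E * d)) (n ^ E) ((2 ^ k) ^ (E * d)) (T ^ d) ⟩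
    n ^ E * (T ^ d * ((2 ^ k) ^ (E * d) * a ^ (E * d)))
      ≡⟨ cong (λ z → n ^ E * (T ^ d * z)) (^-distribʳ-* (E * d) (2 ^ k) a) ⟨
    n ^ E * (T ^ d * (2 ^ k * a) ^ (E * d))
      ≡⟨ cong (λ z → n ^ E * (T ^ d * z)) (trans (cong ((2 ^ k * a) ^_) (exponent' e n)) (sym (^-*-assoc (2 ^ k * a) (suc d) (n * d)))) ⟩
    n ^ E * (T ^ d * ((2 ^ k * a) ^ suc d) ^ (n * d)) ∎)
    where
    open ≤-Reasoning
    d a k E b q : ℕ
    d = suc e
    -- This `a` satisfies `b ≤ a * N ≤ a * n`. The summand 2 in `k` covers the two further terms `n`
    -- in `b * q + n ≤ b + n + n`.
    a = suc d * 2
    k = a + 2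
    E = n * suc d
    b = suc (d * (2 * N))
    q = suc (n / b)

    arith : ∀ x y z → x * (y * z) ≡ x * z * y
    arith = solve-∀
    arith' : ∀ x y z t → x * y * z * t ≡ y * (t * (z * x))
    arith' = solve-∀
    arith'' : ∀ n e → suc (suc e) * (2 * n) + n + n ≡ (suc (suc e) * 2 + 2) * n
    arith'' = solve-∀
    exponent : ∀ e n → n * suc (suc e) + n * (e + e * suc e) ≡ n * suc (suc e) * suc e
    exponent = solve-∀
    exponent' : ∀ e n → n * suc (suc e) * suc e ≡ suc (suc e) * (n * suc e)
    exponent' = solve-∀

    b≤ : b ≤ suc d * (2 * N)
    b≤ = +-monoˡ-≤ (d * (2 * N)) (*-mono-≤ {1} {2} (s≤s z≤n) (>-nonZero⁻¹ N))

    b≤n : b ≤ suc d * (2 * n)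
    b≤n = ≤-trans b≤ (*-monoʳ-≤ (suc d) (*-monoʳ-≤ 2 (≤-trans (n≤n^ N e) lo)))

    levels : b ^ d ≤ a ^ d * n
    levels = begin
      b ^ d                       ≤⟨ ^-monoˡ-≤ d b≤ ⟩
      (suc d * (2 * N)) ^ d       ≡⟨ cong (_^ d) (*-assoc (suc d) 2 N) ⟨
      (a * N) ^ d                 ≡⟨ ^-distribʳ-* d a N ⟩
      a ^ d * N ^ d               ≤⟨ *-monoʳ-≤ (a ^ d) lo ⟩
      a ^ d * n                   ∎

    code : b * q + n ≤ k * n
    code = begin
      b * q + n                   ≤⟨ +-monoˡ-≤ n (quotient-≤ n b) ⟩
      b + n + n                   ≤⟨ +-monoˡ-≤ n (+-monoˡ-≤ n b≤n) ⟩
      suc d * (2 * n) + n + n     ≡⟨ arith'' n e ⟩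
      k * n                       ∎

    seeds : q ^ E ≤ T * (2 ^ k) ^ E
    seeds = begin
      q ^ E                         ≡⟨ ^-*-assoc q n (suc d) ⟨
      (q ^ n) ^ suc d               ≤⟨ T≥ ⟩
      T * (2 ^ (b * q + n)) ^ suc d ≤⟨ *-monoʳ-≤ T (^-monoˡ-≤ (suc d) (^-monoʳ-≤ 2 code)) ⟩
      T * (2 ^ (k * n)) ^ suc d     ≡⟨ cong (T *_) (trans (cong (_^ suc d) (sym (^-*-assoc 2 k n))) (^-*-assoc (2 ^ k) n (suc d))) ⟩
      T * (2 ^ k) ^ E               ∎

  upper-bound : ∀ {κ e} → 0 < κ → (σs : Vec (Vec (Fin (suc κ)) (suc κ)) (suc e)) → (∀ i → Injective (V.lookup σs i)) →
    ∃ λ u → ∀ n → 1 ≤ n → S n σs ^ suc e ≤ u ^ (n * suc e) * n ^ (n * (suc e * suc e ∸ 1))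
  upper-bound {κ} {e} 0<κ σs σs-inj = 2 ^ B * (s * 2) ^ suc d , bound
    where
    d s : ℕ
    d = suc e
    -- A square suffices for `large`: `κ ^ (2 + e)` is below `suc κ ^ (2 + e)`, which is at most
    -- `suc κ ^ (2 * (1 + e))`.
    s = suc κ * suc κ

    large : ∀ e → κ ^ (2 + e) < s ^ (1 + e)
    large e = begin-strict
      κ ^ (2 + e)                        <⟨ ^-monoˡ-< (2 + e) ≤-refl ⟩
      suc κ ^ (2 + e)                    ≡⟨ ^-distribˡ-+-* (suc κ) 1 (suc e) ⟩
      suc κ ^ 1 * suc κ ^ suc e          ≤⟨ *-monoˡ-≤ (suc κ ^ suc e) (≤-trans (≤-reflexive (^-identityʳ (suc κ))) (n≤n^ (suc κ) e)) ⟩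
      suc κ ^ suc e * suc κ ^ suc e      ≡⟨ ^-distribʳ-* (suc e) (suc κ) (suc κ) ⟨
      s ^ suc e                          ∎
      where open ≤-Reasoning

    2≤s^d : 2 ≤ s ^ d
    2≤s^d = ≤-trans (s≤s 0<κ) (≤-trans (m≤m*n (suc κ) (suc κ)) (n≤n^ s e))

    B : ℕ
    B = Covering.familyConstant {κ} s large d

    bound : ∀ n → 1 ≤ n → S n σs ^ d ≤ (2 ^ B * (s * 2) ^ suc d) ^ (n * d) * n ^ (n * (d * d ∸ 1))
    bound n 1≤n with scale s d 2≤s^d n 1≤n
    ... | j , lo , hi = upper-arithmetic e s B n (s ^ j) (S n σs) {{>-nonZero 1≤n}} {{N≢0}} lo hi (≤-trans
      (UpperCount.S-upper {κ} s large σs σs-inj n j (suc (_/_ n (s ^ j) {{N≢0}})) (≤-quotient n (s ^ j) {{N≢0}}))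
      (*-monoˡ-≤ _ (≤-trans (Covering.length-family {κ} s large d 2≤s^d j) (^-monoʳ-≤ 2 (*-monoʳ-≤ B lo)))))
      where
      N≢0 : NonZero (s ^ j)
      N≢0 = m^n≢0 s j

  lower-bound : ∀ {m e} → 1 < m → (σs : Vec (Vec (Fin m) m) (suc e)) →
    ∃ λ u → 1 ≤ u × (∀ n → 1 ≤ n → n ^ (n * (suc e * suc e ∸ 1)) ≤ S n σs ^ suc e * u ^ (n * suc e))
  lower-bound {m} {e} 1<m σs = (2 ^ (a + 2) * a) ^ suc d , positive , bound
    where
    d a : ℕ
    d = suc e
    a = suc d * 2

    positive : 1 ≤ (2 ^ (a + 2) * a) ^ suc d
    positive = m^n>0 (2 ^ (a + 2) * a) {{m*n≢0 (2 ^ (a + 2)) a {{m^n≢0 2 (a + 2)}}}} (suc d)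

    j₀ j₁ : Fin m
    j₀ = fromℕ< (<-trans z<s 1<m)
    j₁ = fromℕ< 1<m

    j₀<j₁ : toℕ j₀ < toℕ j₁
    j₀<j₁ = subst₂ _<_ (sym (toℕ-fromℕ< _)) (sym (toℕ-fromℕ< 1<m)) z<s

    bound : ∀ n → 1 ≤ n → n ^ (n * (d * d ∸ 1)) ≤ S n σs ^ d * ((2 ^ (a + 2) * a) ^ suc d) ^ (n * d)
    bound n 1≤n with scale 2 d (n≤n^ 2 e) n 1≤n
    ... | j , lo , hi = lower-arithmetic e n (2 ^ j) (S n σs) {{>-nonZero 1≤n}} {{m^n≢0 2 j}} lo
      (LowerCount.S-lower σs j₀ j₁ j₀<j₁ level b (suc (n / b)) level-< level-antichain)
      where
      b : ℕ
      -- The base `2 ^ suc j` is the upper end given by `scale`, so that there are at least `n`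
      -- digit vectors; levels run from 0 to `d * 2 ^ suc j`.
      b = suc (d * 2 ^ suc j)
      open Levels (2 ^ suc j) {{m^n≢0 2 (suc j)}} {n} {d} (<⇒≤ hi) (λ i → V.lookup (V.lookup σs i) j₀ <F V.lookup (V.lookup σs i) j₁)

-- From natural-number bounds to rational constants

module RationalPowers where

  open import Defs using (_^ℚ_)
  open import Data.Nat as ℕ using (ℕ; zero; suc; _^_)
  import Data.Nat.Properties as ℕ
  open import Data.Integer using (+_)
  import Data.Integer as ℤ
  import Data.Integer.Properties as ℤ
  open import Data.Rational
  open import Data.Rational.Properties
  open import Data.Rational.Unnormalised using (mkℚᵘ; *≡*; *≤*)
  import Data.Rational.Unnormalised.Properties as ℚᵘ
  open import Data.Product using (Σ; ∃; _×_; _,_)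
  open import Relation.Binary.PropositionalEquality using (_≡_; refl; sym; trans; cong; cong₂; subst)

  fromℕ : ℕ → ℚ
  fromℕ k = + k / 1

  fromℕ-* : ∀ a b → fromℕ (a ℕ.* b) ≡ fromℕ a * fromℕ b
  fromℕ-* a b = toℚᵘ-injective (ℚᵘ.≃-trans (toℚᵘ-fromℚᵘ (mkℚᵘ (+ (a ℕ.* b)) 0))
    (ℚᵘ.≃-trans (*≡* (cong (ℤ._* ℤ.1ℤ) (ℤ.pos-* a b)))
    (ℚᵘ.≃-sym (ℚᵘ.≃-trans (toℚᵘ-homo-* (fromℕ a) (fromℕ b))
      (ℚᵘ.*-cong (toℚᵘ-fromℚᵘ (mkℚᵘ (+ a) 0)) (toℚᵘ-fromℚᵘ (mkℚᵘ (+ b) 0)))))))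

  fromℕ-≤ : ∀ {a b} → a ℕ.≤ b → fromℕ a ≤ fromℕ b
  fromℕ-≤ {a} {b} a≤b = toℚᵘ-cancel-≤
    (ℚᵘ.≤-respˡ-≃ (ℚᵘ.≃-sym (toℚᵘ-fromℚᵘ (mkℚᵘ (+ a) 0)))
    (ℚᵘ.≤-respʳ-≃ (ℚᵘ.≃-sym (toℚᵘ-fromℚᵘ (mkℚᵘ (+ b) 0)))
      (*≤* (ℤ.*-monoʳ-≤-nonNeg ℤ.1ℤ (ℤ.+≤+ a≤b)))))

  fromℕ-nonNeg : ∀ k → NonNegative (fromℕ k)
  fromℕ-nonNeg k = normalize-nonNeg k 1

  fromℕ-^ : ∀ k t → fromℕ (k ^ t) ≡ fromℕ k ^ℚ t
  fromℕ-^ k zero    = refl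
  fromℕ-^ k (suc t) = trans (fromℕ-* k (k ^ t)) (cong (fromℕ k *_) (fromℕ-^ k t))

  ^ℚ-nonNeg : ∀ p {{_ : NonNegative p}} t → NonNegative (p ^ℚ t)
  ^ℚ-nonNeg p zero    = _
  ^ℚ-nonNeg p (suc t) = nonNeg*nonNeg⇒nonNeg p (p ^ℚ t) {{^ℚ-nonNeg p t}}

  ^ℚ-mono-≤ : ∀ {p q} {{_ : NonNegative p}} {{_ : NonNegative q}} → p ≤ q → ∀ t → p ^ℚ t ≤ q ^ℚ t
  ^ℚ-mono-≤         p≤q zero    = ≤-refl
  ^ℚ-mono-≤ {p} {q} p≤q (suc t) = ≤-trans (*-monoˡ-≤-nonNeg p (^ℚ-mono-≤ p≤q t))
    (*-monoʳ-≤-nonNeg (q ^ℚ t) {{^ℚ-nonNeg q t}} p≤q)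

  ^ℚ-inverse : ∀ p q → p * q ≡ 1ℚ → ∀ t → p ^ℚ t * q ^ℚ t ≡ 1ℚ
  ^ℚ-inverse p q pq zero    = refl
  ^ℚ-inverse p q pq (suc t) = begin
    p * (p ^ℚ t) * (q * (q ^ℚ t))    ≡⟨ *-assoc p (p ^ℚ t) (q * (q ^ℚ t)) ⟩
    p * ((p ^ℚ t) * (q * (q ^ℚ t)))  ≡⟨ cong (p *_) (*-assoc (p ^ℚ t) q (q ^ℚ t)) ⟨
    p * ((p ^ℚ t) * q * (q ^ℚ t))    ≡⟨ cong (λ z → p * (z * (q ^ℚ t))) (*-comm (p ^ℚ t) q) ⟩
    p * (q * (p ^ℚ t) * (q ^ℚ t))    ≡⟨ cong (p *_) (*-assoc q (p ^ℚ t) (q ^ℚ t)) ⟩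
    p * (q * ((p ^ℚ t) * (q ^ℚ t)))  ≡⟨ *-assoc p q ((p ^ℚ t) * (q ^ℚ t)) ⟨
    p * q * ((p ^ℚ t) * (q ^ℚ t))    ≡⟨ cong₂ _*_ pq (^ℚ-inverse p q pq t) ⟩
    1ℚ * 1ℚ                          ≡⟨⟩
    1ℚ                               ∎
    where open Relation.Binary.PropositionalEquality.≡-Reasoning

  module Constants (u v : ℕ) (1≤u : 1 ℕ.≤ u) where

    instance
      u-pos : Positive (fromℕ u)
      u-pos = normalize-pos u 1 {{_}} {{ℕ.>-nonZero 1≤u}}

      u≢0 : NonZero (fromℕ u)
      u≢0 = pos⇒nonZero (fromℕ u)

    c₁ c₂ : ℚ
    c₁ = 1/ fromℕ u
    -- The positive summand makes `c₁ < c₂` hold for all `u` and `v`, while the sum stays above `v`.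
    c₂ = c₁ + fromℕ (suc v)

    instance
      c₁-pos : Positive c₁
      c₁-pos = 1/pos⇒pos (fromℕ u)

      c₁-nonNeg : NonNegative c₁
      c₁-nonNeg = pos⇒nonNeg c₁

    0<c₁ : 0ℚ < c₁
    0<c₁ = positive⁻¹ c₁

    c₁<c₂ : c₁ < c₂
    c₁<c₂ = subst (_< c₂) (+-identityʳ c₁)
      (+-monoʳ-< c₁ (positive⁻¹ (fromℕ (suc v)) {{normalize-pos (suc v) 1}}))

    v≤c₂ : fromℕ v ≤ c₂
    v≤c₂ = ≤-trans (fromℕ-≤ (ℕ.n≤1+n v))
      (subst (_≤ c₂) (+-identityˡ (fromℕ (suc v))) (+-monoˡ-≤ (fromℕ (suc v)) (<⇒≤ 0<c₁)))

    c₁-bound : ∀ t a b → a ℕ.≤ b ℕ.* u ^ t → c₁ ^ℚ t * fromℕ a ≤ fromℕ b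
    c₁-bound t a b h = ≤-trans (*-monoˡ-≤-nonNeg (c₁ ^ℚ t) {{^ℚ-nonNeg c₁ t}} (fromℕ-≤ h)) (≤-reflexive (begin
      (c₁ ^ℚ t) * fromℕ (b ℕ.* u ^ t)              ≡⟨ cong ((c₁ ^ℚ t) *_) (trans (fromℕ-* b (u ^ t)) (*-comm (fromℕ b) _)) ⟩
      (c₁ ^ℚ t) * (fromℕ (u ^ t) * fromℕ b)        ≡⟨ *-assoc (c₁ ^ℚ t) (fromℕ (u ^ t)) (fromℕ b) ⟨
      (c₁ ^ℚ t) * fromℕ (u ^ t) * fromℕ b          ≡⟨ cong (λ z → (c₁ ^ℚ t) * z * fromℕ b) (fromℕ-^ u t) ⟩
      (c₁ ^ℚ t) * (fromℕ u ^ℚ t) * fromℕ b         ≡⟨ cong (_* fromℕ b) (^ℚ-inverse c₁ (fromℕ u) (*-inverseˡ (fromℕ u)) t) ⟩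
      1ℚ * fromℕ b                                 ≡⟨ *-identityˡ (fromℕ b) ⟩
      fromℕ b                                      ∎))
      where open Relation.Binary.PropositionalEquality.≡-Reasoning

    c₂-bound : ∀ t a b → b ℕ.≤ v ^ t ℕ.* a → fromℕ b ≤ c₂ ^ℚ t * fromℕ a
    c₂-bound t a b h = ≤-trans (fromℕ-≤ h) (≤-trans
      (≤-reflexive (trans (fromℕ-* (v ^ t) a) (cong (_* fromℕ a) (fromℕ-^ v t))))
      (*-monoʳ-≤-nonNeg (fromℕ a) {{fromℕ-nonNeg a}}
        (^ℚ-mono-≤ {{fromℕ-nonNeg v}} {{c₂-nonNeg}} v≤c₂ t)))
      where
      c₂-nonNeg : NonNegative c₂
      c₂-nonNeg = nonNegative (≤-trans (<⇒≤ 0<c₁) (<⇒≤ c₁<c₂))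

  rational-constants : (t f g : ℕ → ℕ) →
    (∃ λ u → 1 ℕ.≤ u × (∀ n → 1 ℕ.≤ n → f n ℕ.≤ g n ℕ.* u ^ t n)) →
    (∃ λ v → ∀ n → 1 ℕ.≤ n → g n ℕ.≤ v ^ t n ℕ.* f n) →
    Σ ℚ λ c₁ → Σ ℚ λ c₂ → 0ℚ < c₁ × c₁ < c₂ ×
      (∀ n → 1 ℕ.≤ n → c₁ ^ℚ t n * fromℕ (f n) ≤ fromℕ (g n) × fromℕ (g n) ≤ c₂ ^ℚ t n * fromℕ (f n))
  rational-constants t f g (u , 1≤u , lower) (v , upper) = c₁ , c₂ , 0<c₁ , c₁<c₂ , λ n 1≤n →
    c₁-bound (t n) (f n) (g n) (lower n 1≤n) , c₂-bound (t n) (f n) (g n) (upper n 1≤n)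
    where open Constants u v 1≤u

open import Data.Nat using (ℕ; _<_; _≤_; _^_; _∸_)
open import Data.Nat as ℕ using ()
open import Data.Bool using (true)
open import Data.Fin using (Fin)
open import Data.Vec using (Vec)
open import Data.Vec.Relation.Unary.All using (All)
open import Data.Product using (Σ; _×_)
open import Data.Rational using (ℚ; 0ℚ; _*_; _/_)
open import Data.Rational as ℚ using ()
open import Data.Integer using (+_)
open import Relation.Binary.PropositionalEquality using (_≡_)
open import Data.Nat using (suc; s≤s)
open import Data.Product using (_,_)
open import Data.Vec using (lookup)
open import Data.Vec.Membership.Propositional.Properties using (∈-lookup)
import Data.Vec.Relation.Unary.All as All
open Enumeration using (isPermB⇒Injective; upper-bound; lower-bound)
open RationalPowers using (rational-constants)

theorem3p5 : (m d : ℕ) → 1 < m → 1 ≤ d → (σs : Vec (Vec (Fin m) m) d) →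
    All (λ σ → isPermB σ ≡ true) σs →
    Σ ℚ λ c₁ → Σ ℚ λ c₂ → (0ℚ ℚ.< c₁) × (c₁ ℚ.< c₂) ×
    ((n : ℕ) → 1 ≤ n →
    ((c₁ ^ℚ (n ℕ.* d)) * (+ (n ^ (n ℕ.* (d ℕ.* d ∸ 1))) / 1) ℚ.≤ (+ (S n σs ^ d) / 1))
    × ((+ (S n σs ^ d) / 1) ℚ.≤ (c₂ ^ℚ (n ℕ.* d)) * (+ (n ^ (n ℕ.* (d ℕ.* d ∸ 1))) / 1)))
theorem3p5 (suc κ) (suc e) 1<m@(s≤s 0<κ) _ σs perms = rational-constants
  (λ n → n ℕ.* suc e) (λ n → n ^ (n ℕ.* (suc e ℕ.* suc e ∸ 1))) (λ n → S n σs ^ suc e)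
  (lower-bound 1<m σs)
  (upper-bound 0<κ σs λ i → isPermB⇒Injective (lookup σs i) (All.lookup perms (∈-lookup i σs)))
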